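{- For all integers $d,h\ge 2$, $$\frac{(d-1)h}{2}-\frac d2\ \le\ \#\mathrm{FRpebbles}(T^h_d)\ \le\ \frac{(d-1)h}{2}+1,$$ and moreover $\#\mathrm{FRpebbles}(T^3_d)=\frac32 d-\frac12$ for all $d\ge 2$, and $\#\mathrm{FRpebbles}(T^4_2)=3$.
   Context: $T^h_d$ is the balanced rooted $d$-ary tree with $h$ levels (height counts levels; $T^2_2$ has 3 nodes). A fractional pebble configuration on a rooted tree assigns to each node $i$ a pair of reals $(b(i),w(i))$ with $b(i),w(i)\ge 0$ and $b(i)+w(i)\le 1$ (black and white pebble values; $b(i)+w(i)$ is the pebble value of $i$); the number of pebbles in the configuration is the sum of all pebble values. Legal moves (always preserving these constraints): (i) decrease $b(i)$ arbitrarily for any node $i$; (ii) increase $w(i)$ arbitrarily for any node $i$; (iii) for any node $i$ all of whose children have pebble value $1$ (vacuous for leaves): decrease $w(i)$ to $0$, increase $b(i)$ arbitrarily, and simultaneously decrease the black values of the children of $i$ arbitrarily. A fractional pebbling using $p$ pebbles is a sequence of legal moves starting and ending with all pebble values $0$, such that at some point the root has black value $1$, and no configuration has more than $p$ pebbles. $\#\mathrm{FRpebbles}(T)$ is the minimum $p$ for which $T$ has a fractional pebbling using $p$ pebbles.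
   Formalization: Black and white pebble values, and the number p of pebbles, are taken to be rational numbers instead of reals; each bound on the minimum is stated as existence of a pebbling or as a lower bound over all pebblings. -}

module Defs where

open import Data.Nat as ℕ using (ℕ; zero; suc)
open import Data.Fin using (Fin)
open import Data.Vec using (Vec; []; _∷_; lookup; replicate; foldr; _[_]≔_)
open import Data.Vec.Relation.Unary.All as VAll using ()
open import Data.Rational using (ℚ; 0ℚ; 1ℚ; _+_; _≤_)
open import Data.Product using (Σ; _×_; _,_; proj₁; proj₂)
open import Data.Unit using (⊤; tt)
open import Data.Sum using (_⊎_)
open import Data.Maybe using (Maybe; just)
open import Data.List using (List; head; last)
open import Data.List.Relation.Unary.All using (All)
open import Data.List.Relation.Unary.Any using (Any)
open import Data.List.Relation.Unary.Linked using (Linked)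
open import Relation.Binary.PropositionalEquality using (_≡_)

Val : Set
Val = ℚ × ℚ

blk wht pval : Val → ℚ
blk = proj₁
wht = proj₂
pval v = blk v + wht v

-- A configuration on the balanced d-ary tree T^h_d (h levels):
-- height 0 = empty tree; height suc h = root value + d subtrees of height h.
Config : ℕ → ℕ → Set
Config d zero    = ⊤
Config d (suc h) = Val × Vec (Config d h) d

empty : ∀ d h → Config d h
empty d zero    = tt
empty d (suc h) = (0ℚ , 0ℚ) , replicate d (empty d h)

ValidVal : Val → Set
ValidVal v = (0ℚ ≤ blk v) × (0ℚ ≤ wht v) × (pval v ≤ 1ℚ)

Valid : ∀ {d} h → Config d h → Set
Valid zero    _        = ⊤
Valid (suc h) (v , cs) = ValidVal v × VAll.All (Valid h) cs

pebbles : ∀ {d} h → Config d h → ℚ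
pebbles zero    _        = 0ℚ
pebbles (suc h) (v , cs) = pval v + foldr (λ _ → ℚ) (λ c s → pebbles h c + s) 0ℚ cs

rootBlack : ∀ {d} h → Config d h → ℚ
rootBlack zero    _       = 0ℚ
rootBlack (suc h) (v , _) = blk v

-- root of a (nonempty) subtree has pebble value 1 (vacuous for empty subtrees,
-- i.e. for children of leaves)
RootFull : ∀ {d} h → Config d h → Set
RootFull zero    _       = ⊤
RootFull (suc h) (v , _) = pval v ≡ 1ℚ

RootBlackDec : ∀ {d} h → Config d h → Config d h → Set
RootBlackDec zero    _        _          = ⊤
RootBlackDec (suc h) (v , cs) (v' , cs') =
  (blk v' ≤ blk v) × (wht v' ≡ wht v) × (cs' ≡ cs)

data Move {d : ℕ} : (h : ℕ) → Config d h → Config d h → Set where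
  decBlack : ∀ {h} {b w b' : ℚ} {cs} → b' ≤ b →
             Move (suc h) ((b , w) , cs) ((b' , w) , cs)
  incWhite : ∀ {h} {b w w' : ℚ} {cs} → w ≤ w' →
             Move (suc h) ((b , w) , cs) ((b , w') , cs)
  place    : ∀ {h} {b w b' : ℚ} {cs cs'} →
             VAll.All (RootFull h) cs →
             b ≤ b' →
             (∀ k → RootBlackDec h (lookup cs k) (lookup cs' k)) →
             Move (suc h) ((b , w) , cs) ((b' , 0ℚ) , cs')
  inside   : ∀ {h} {v : Val} {cs} (k : Fin d) {c' : Config d h} →
             Move h (lookup cs k) c' →
             Move (suc h) (v , cs) (v , (cs [ k ]≔ c'))

FracPebbling : (d h : ℕ) → ℚ → Set
FracPebbling d h p =
  Σ (List (Config d h)) λ cs →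
    (head cs ≡ just (empty d h)) ×
    (last cs ≡ just (empty d h)) ×
    Linked (Move h) cs ×
    All (Valid h) cs ×
    Any (λ c → rootBlack h c ≡ 1ℚ) cs ×
    All (λ c → pebbles h c ≤ p) cs

{-# OPTIONS --safe #-}
-- Upper bound (d-1)h/2 + 1: bring all children of the root but one to black
-- value ½, cleaning up their subtrees, then pebble the last child without
-- cleaning up, fill the other children with white ½, pebble the root, and undo
-- everything in the opposite order.
--
-- General lower bound, in the spirit of Klawe's argument for pyramids: each
-- black pebble is charged to itself or to a frontier of nodes below it that is
-- blocked by white pebbles topped up with extra weight.  Write K = d-1 and
-- require K j + 2 (extra weight on levels ≥ j) ≤ M for all j.  A move keeps the
-- charging valid unless it pebbles a parent of leaves, and then d pebbles are
-- on these leaves.  A frontier carrying more extra weight than the pebbles it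
-- accounts for can be replaced by the black pebbles above it without violating
-- the bound, because a frontier reaching down t levels has at least 1 + K t
-- nodes.  In the end the root is blocked with no white pebble left, which forces
-- M to be large.
--
-- Heights 3 and 4: between the last move before and the first move after the
-- pebbling of the root that pebble a parent of leaves, every child of the root is
-- covered by black pebbles present at the former move and white pebbles present
-- at the latter, while at both moments d pebbles are on leaves.
module Submission where

open import Defs
open import Data.Nat as ℕ using (ℕ; zero; suc; z≤n; s≤s; _∸_; _⊓_)
import Data.Nat.Properties as ℕ
open import Data.Fin using (Fin; zero; suc)
open import Data.Fin.Properties using () renaming (_≟_ to _≟ᶠ_)
import Data.Integer as ℤ
open import Data.Vec using (Vec; []; _∷_; lookup; replicate; foldr; _[_]≔_)
open import Data.Vec.Properties using (lookup-replicate; lookup∘update; lookup∘update′)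
open import Data.Vec.Relation.Unary.All as VAll using ([]; _∷_)
open import Data.Vec.Relation.Unary.All.Properties using () renaming (lookup⁺ to child)
open import Data.Rational using (ℚ; 0ℚ; 1ℚ; ½; _/_; _+_; _-_; -_; _≤_; toℚᵘ)
open import Data.Rational.Properties
import Data.Rational.Unnormalised as ℚᵘ
import Data.Rational.Unnormalised.Properties as ℚᵘ
open import Data.Product using (Σ; _×_; _,_; proj₁; proj₂)
open import Data.Sum using (_⊎_; inj₁; inj₂)
open import Data.Unit using (⊤; tt)
open import Data.Empty using (⊥; ⊥-elim)
open import Data.List using (List; []; _∷_; last)
open import Data.List.Relation.Unary.All as LAll using (All; []; _∷_)
open import Data.List.Relation.Unary.Any using (Any; here; there)
open import Data.List.Relation.Unary.Linked using (Linked; [-]; _∷_)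
open import Data.Maybe using (just)
open import Data.Maybe.Properties using (just-injective)
open import Function using (_∘_)
open import Relation.Nullary using (¬_; yes; no)
open import Relation.Nullary.Decidable using (dec⇒maybe)
open import Relation.Binary.Definitions using (tri<; tri≈; tri>)
open import Relation.Binary.PropositionalEquality
open import Tactic.RingSolver.Core.AlmostCommutativeRing using (AlmostCommutativeRing; fromCommutativeRing)
open import Tactic.RingSolver using (solve-∀)

-- Linear arithmetic over the rationals.

ring : AlmostCommutativeRing _ _
ring = fromCommutativeRing +-*-commutativeRing λ x → dec⇒maybe (0ℚ ≟ x)

-- A linear inequality follows from a nonnegative combination a ≤ b of its
-- hypotheses and a ring identity.
lin : ∀ {x y a b} → a ≤ b → x + b ≡ y + a → x ≤ y
lin {x} {y} {a} {b} a≤b eq = begin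
  x              ≡⟨ shift x a ⟩
  x + a - a      ≤⟨ +-monoˡ-≤ (- a) (+-monoʳ-≤ x a≤b) ⟩
  x + b - a      ≡⟨ cong (_- a) eq ⟩
  y + a - a      ≡⟨ shift y a ⟨
  y              ∎
  where
  open ≤-Reasoning
  shift : ∀ u v → u ≡ u + v - v
  shift = solve-∀ ring

halve-≤ : ∀ {x y} → x + x ≤ y + y → x ≤ y
halve-≤ {x} {y} le with ≤-total x y
... | inj₁ x≤y = x≤y
... | inj₂ y≤x = lin (+-mono-≤ le y≤x) (arrange x y)
  where
  arrange : ∀ x y → x + (y + y + x) ≡ y + (x + x + y)
  arrange = solve-∀ ring

infixl 7 _·_
_·_ : ℕ → ℚ → ℚ
zero  · q = 0ℚ
suc n · q = q + n · q

·-nonneg : ∀ n {q} → 0ℚ ≤ q → 0ℚ ≤ n · q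
·-nonneg zero    0≤q = ≤-refl
·-nonneg (suc n) 0≤q = +-mono-≤ 0≤q (·-nonneg n 0≤q)

·-mono : ∀ n {x y} → x ≤ y → n · x ≤ n · y
·-mono zero    x≤y = ≤-refl
·-mono (suc n) x≤y = +-mono-≤ x≤y (·-mono n x≤y)

·-double : ∀ n q → n · q + n · q ≡ n · (q + q)
·-double zero    q = refl
·-double (suc n) q = trans (shuffle q (n · q)) (cong (q + q +_) (·-double n q))
  where
  shuffle : ∀ a b → a + b + (a + b) ≡ a + a + (b + b)
  shuffle = solve-∀ ring

·-mono-ℕ : ∀ {m n q} → 0ℚ ≤ q → m ℕ.≤ n → m · q ≤ n · q
·-mono-ℕ {n = n} 0≤q z≤n = ·-nonneg n 0≤q
·-mono-ℕ {q = q} 0≤q (s≤s m≤n) = +-monoʳ-≤ q (·-mono-ℕ 0≤q m≤n)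

·-distrib-+ : ∀ m n q → (m ℕ.+ n) · q ≡ m · q + n · q
·-distrib-+ zero    n q = sym (+-identityˡ (n · q))
·-distrib-+ (suc m) n q = trans (cong (q +_) (·-distrib-+ m n q)) (sym (+-assoc q (m · q) (n · q)))

0≤1 : 0ℚ ≤ 1ℚ
0≤1 = nonNegative⁻¹ 1ℚ

-- Finite sums.

∑ : ∀ {n} → (Fin n → ℚ) → ℚ
∑ {zero}  f = 0ℚ
∑ {suc n} f = f zero + ∑ (f ∘ suc)

∑-mono : ∀ {n} {f g : Fin n → ℚ} → (∀ k → f k ≤ g k) → ∑ f ≤ ∑ g
∑-mono {zero}  f≤g = ≤-refl
∑-mono {suc n} f≤g = +-mono-≤ (f≤g zero) (∑-mono (f≤g ∘ suc))

∑-nonneg : ∀ {n} {f : Fin n → ℚ} → (∀ k → 0ℚ ≤ f k) → 0ℚ ≤ ∑ f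
∑-nonneg {zero}  0≤f = ≤-refl
∑-nonneg {suc n} 0≤f = +-mono-≤ (0≤f zero) (∑-nonneg (0≤f ∘ suc))

∑-+ : ∀ {n} (f g : Fin n → ℚ) → ∑ (λ k → f k + g k) ≡ ∑ f + ∑ g
∑-+ {zero}  f g = refl
∑-+ {suc n} f g = trans (cong (f zero + g zero +_) (∑-+ (f ∘ suc) (g ∘ suc)))
                        (shuffle (f zero) (g zero) _ _)
  where
  shuffle : ∀ a b c d → a + b + (c + d) ≡ a + c + (b + d)
  shuffle = solve-∀ ring

∑-nonpos : ∀ {n} {f : Fin n → ℚ} → (∀ k → f k ≤ 0ℚ) → ∑ f ≤ 0ℚ
∑-nonpos {zero}  f≤0 = ≤-refl
∑-nonpos {suc n} f≤0 = +-mono-≤ (f≤0 zero) (∑-nonpos (f≤0 ∘ suc))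

∑-const : ∀ n x → ∑ {n} (λ _ → x) ≡ n · x
∑-const zero    x = refl
∑-const (suc n) x = cong (x +_) (∑-const n x)

-- For moves that change a single subtree: the correction `e`, which may be negative, enters only
-- once.
∑-except : ∀ {n} {f f' : Fin n → ℚ} {e} k₀ → f' k₀ ≤ f k₀ + e →
           (∀ k → ¬ k ≡ k₀ → f' k ≤ f k) → ∑ f' ≤ ∑ f + e
∑-except {suc n} {f} {f'} {e} zero at off =
  ≤-trans (+-mono-≤ at (∑-mono (λ k → off (suc k) (λ ()))))
          (≤-reflexive (shuffle (f zero) e _))
  where
  shuffle : ∀ a b c → a + b + c ≡ a + c + b
  shuffle = solve-∀ ring
∑-except {suc n} {f} {f'} {e} (suc k₀) at off =
  ≤-trans (+-mono-≤ (off zero (λ ())) (∑-except k₀ at λ k k≢ → off (suc k) λ { refl → k≢ refl }))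
          (≤-reflexive (sym (+-assoc (f zero) _ e)))

-- Apply `∑-except` with the correction `g k₀ - f k₀`. With constant `g` this bounds `∑ f` below by
-- one exact term and a uniform bound on the others.
∑-pick : ∀ {n} {f g : Fin n → ℚ} k₀ → (∀ k → g k ≤ f k) → f k₀ + ∑ g ≤ ∑ f + g k₀
∑-pick {f = f} {g} k₀ g≤f =
  lin (∑-except {f = f} {f' = g} {e = g k₀ - f k₀} k₀ (≤-reflexive (cancel (g k₀) (f k₀))) (λ k _ → g≤f k))
      (arrange (f k₀) (∑ g) (∑ f) (g k₀))
  where
  cancel : ∀ a b → a ≡ b + (a - b)
  cancel = solve-∀ ring
  arrange : ∀ a b c d → a + b + (c + (d - a)) ≡ c + d + b
  arrange = solve-∀ ring

∑-zero : ∀ {n} {f : Fin n → ℚ} → (∀ k → f k ≡ 0ℚ) → ∑ f ≡ 0ℚ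
∑-zero {zero}  f≡0 = refl
∑-zero {suc n} f≡0 = cong₂ _+_ (f≡0 zero) (∑-zero (f≡0 ∘ suc))

∑-≥ : ∀ {n} {f : Fin n → ℚ} k → (∀ i → 0ℚ ≤ f i) → f k ≤ ∑ f
∑-≥ {n} {f} k 0≤f =
  lin (∑-pick {f = f} {g = λ _ → 0ℚ} k 0≤f)
      (trans (arrange (f k) (∑ f)) (cong (λ z → ∑ f + (f k + z)) (sym (∑-zero {n} (λ _ → refl)))))
  where
  arrange : ∀ a b → a + (b + 0ℚ) ≡ b + (a + 0ℚ)
  arrange = solve-∀ ring

-- Pebble totals of forests.

total : ∀ {d n} h → Vec (Config d h) n → ℚ
total h = foldr (λ _ → ℚ) (λ c s → pebbles h c + s) 0ℚ

total-∑ : ∀ {d n} h (cs : Vec (Config d h) n) → total h cs ≡ ∑ (λ k → pebbles h (lookup cs k))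
total-∑ h []       = refl
total-∑ h (c ∷ cs) = cong (pebbles h c +_) (total-∑ h cs)

pebbles-nonneg : ∀ {d} h (c : Config d h) → Valid h c → 0ℚ ≤ pebbles h c
pebbles-nonneg zero    c        v = ≤-refl
pebbles-nonneg (suc h) (x , cs) ((0≤b , 0≤w , _) , v) =
  +-mono-≤ (+-mono-≤ 0≤b 0≤w)
    (≤-trans (∑-nonneg (λ k → pebbles-nonneg h (lookup cs k) (child v k))) (≤-reflexive (sym (total-∑ h cs))))

full-≤-total : ∀ {d h n} (cs : Vec (Config d (suc h)) n) → VAll.All (Valid (suc h)) cs →
               VAll.All (RootFull (suc h)) cs → n · 1ℚ ≤ total (suc h) cs
full-≤-total []       []       []        = ≤-refl
full-≤-total {d} {h} ((y , ds) ∷ cs) ((_ , v) ∷ vs) (eq ∷ eqs) = +-mono-≤ one (full-≤-total cs vs eqs)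
  where
  one : 1ℚ ≤ pval y + total h ds
  one = ≤-trans (≤-reflexive (trans (sym eq) (sym (+-identityʳ (pval y)))))
    (+-monoʳ-≤ (pval y) (≤-trans (∑-nonneg (λ k → pebbles-nonneg {d} h (lookup ds k) (child v k)))
                                 (≤-reflexive (sym (total-∑ {d} h ds)))))

-- Pebblings as composable paths.

data Chain {A : Set} (R : A → A → Set) (P : A → Set) : A → A → Set where
  stop : ∀ {a} → P a → Chain R P a a
  step : ∀ {a b c} → P a → R a b → Chain R P b c → Chain R P a c

module _ {A : Set} {R : A → A → Set} {P : A → Set} where

  infixr 5 _⊳_ _⊳[_]_
  _⊳_ : ∀ {a b c} → Chain R P a b → Chain R P b c → Chain R P a c
  stop _     ⊳ q = q
  step x r p ⊳ q = step x r (p ⊳ q)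

  _⊳[_]_ : ∀ {a b c e} → Chain R P a b → R b c → Chain R P c e → Chain R P a e
  stop x     ⊳[ r ] q = step x r q
  step x s p ⊳[ r ] q = step x s (p ⊳[ r ] q)

  end : ∀ {a b} → Chain R P a b → P b
  end (stop x)     = x
  end (step _ _ p) = end p

  start : ∀ {a b} → Chain R P a b → P a
  start (stop x)     = x
  start (step x _ _) = x

map-chain : ∀ {A B : Set} {R : A → A → Set} {S : B → B → Set} {P : A → Set} {Q : B → Set} (f : A → B) →
            (∀ {a b} → R a b → S (f a) (f b)) → (∀ {a} → P a → Q (f a)) →
            ∀ {a b} → Chain R P a b → Chain S Q (f a) (f b)
map-chain f g h (stop x)     = stop (h x)
map-chain f g h (step x r p) = step (h x) (g r) (map-chain f g h p)

Ok : ∀ {d} h → ℚ → Config d h → Set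
Ok h q c = Valid h c × pebbles h c ≤ q

Path : ∀ {d} h → ℚ → Config d h → Config d h → Set
Path h q = Chain (Move h) (Ok h q)

module _ {d h : ℕ} {q : ℚ} where

  private
    rest : ∀ {a b : Config d h} → Path h q a b → List (Config d h)
    rest (stop _)               = []
    rest (step {b = b} _ _ p)   = b ∷ rest p

    linked : ∀ {a b} (p : Path h q a b) → Linked (Move h) (a ∷ rest p)
    linked (stop _)     = [-]
    linked (step _ m p) = m ∷ linked p

    all-ok : ∀ {a b} (p : Path h q a b) → All (Ok h q) (a ∷ rest p)
    all-ok (stop x)     = x ∷ []
    all-ok (step x _ p) = x ∷ all-ok p

    last-rest : ∀ {a b} (p : Path h q a b) → last (a ∷ rest p) ≡ just b
    last-rest (stop _)     = refl
    last-rest (step _ _ p) = last-rest p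

    joint : ∀ {a b c} {P : Config d h → Set} (p : Path h q a b) (p' : Path h q b c) →
            P b → Any P (a ∷ rest (p ⊳ p'))
    joint (stop _)     p' x = here x
    joint (step _ _ p) p' x = there (joint p p' x)

  fromPaths : ∀ {c} → Path h q (empty d h) c → rootBlack h c ≡ 1ℚ → Path h q c (empty d h) →
              FracPebbling d h q
  fromPaths p black p' =
    (empty d h ∷ rest (p ⊳ p')) , refl , last-rest (p ⊳ p') , linked (p ⊳ p') ,
    LAll.map proj₁ (all-ok (p ⊳ p')) , joint p p' black , LAll.map proj₂ (all-ok (p ⊳ p'))

  private
    toPath : ∀ {c e cs} → last (c ∷ cs) ≡ just e → Linked (Move h) (c ∷ cs) →
             All (Valid h) (c ∷ cs) → All (λ (c : Config d h) → pebbles h c ≤ q) (c ∷ cs) → Path h q c e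
    toPath eq [-]      (v ∷ _)  (b ∷ _)  with refl ← just-injective eq = stop (v , b)
    toPath eq (m ∷ ms) (v ∷ vs) (b ∷ bs) = step (v , b) m (toPath eq ms vs bs)

    splitPath : ∀ {c e cs} {P : Config d h → Set} → last (c ∷ cs) ≡ just e →
                Linked (Move h) (c ∷ cs) → All (Valid h) (c ∷ cs) →
                Any P (c ∷ cs) → All (λ (c : Config d h) → pebbles h c ≤ q) (c ∷ cs) →
                Σ (Config d h) λ c' → P c' × Path h q c c' × Path h q c' e
    splitPath eq ms vs (here x) bs =
      _ , x , stop (LAll.head vs , LAll.head bs) , toPath eq ms vs bs
    splitPath eq (m ∷ ms) (v ∷ vs) (there any) (b ∷ bs) =
      let c' , x , p , p' = splitPath eq ms vs any bs in c' , x , step (v , b) m p , p'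

  toPaths : FracPebbling d h q →
            Σ (Config d h) λ c → rootBlack h c ≡ 1ℚ × Path h q (empty d h) c × Path h q c (empty d h)
  toPaths (c ∷ cs , hd , lst , ms , vs , any , bs) with refl ← just-injective hd =
    splitPath lst ms vs any bs

-- Upper bound

-- The number `n` of trees is independent of the arity `d`, so that the children of a node can be
-- treated by induction on their number.
data ForestMove {d h n : ℕ} : Vec (Config d h) n → Vec (Config d h) n → Set where
  move-at : ∀ {cs} k {c'} → Move h (lookup cs k) c' → ForestMove cs (cs [ k ]≔ c')

ForestOk : ∀ {d n} h → ℚ → Vec (Config d h) n → Set
ForestOk h q cs = VAll.All (Valid h) cs × total h cs ≤ q

ForestPath : ∀ {d n} h → ℚ → Vec (Config d h) n → Vec (Config d h) n → Set
ForestPath h q = Chain ForestMove (ForestOk h q)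

module _ {d h : ℕ} where

  on-head : ∀ {n q q'} {c c' : Config d h} {cs : Vec (Config d h) n} →
            VAll.All (Valid h) cs → q + total h cs ≤ q' →
            Path h q c c' → ForestPath h q' (c ∷ cs) (c' ∷ cs)
  on-head {cs = cs} vs le =
    map-chain (_∷ cs) (move-at zero) λ (v , b) → v ∷ vs , ≤-trans (+-monoˡ-≤ _ b) le

  on-tail : ∀ {n q q'} {c : Config d h} {cs cs' : Vec (Config d h) n} →
            Valid h c → pebbles h c + q ≤ q' →
            ForestPath h q cs cs' → ForestPath h q' (c ∷ cs) (c ∷ cs')
  on-tail {c = c} v le =
    map-chain (c ∷_) (λ { (move-at k m) → move-at (suc k) m }) λ (vs , b) → v ∷ vs , ≤-trans (+-monoʳ-≤ (pebbles h c) b) le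

  under : ∀ {q q' v} {cs cs' : Vec (Config d h) d} → ValidVal v → pval v + q ≤ q' →
          ForestPath h q cs cs' → Path (suc h) q' (v , cs) (v , cs')
  under {v = v} vv le =
    map-chain (v ,_) (λ { (move-at k m) → inside k m }) λ (vs , b) → (vv , vs) , ≤-trans (+-monoʳ-≤ (pval v) b) le

  all-replicate : ∀ n {c : Config d h} → Valid h c → VAll.All (Valid h) (replicate n c)
  all-replicate zero    v = []
  all-replicate (suc n) v = v ∷ all-replicate n v

  total-replicate : ∀ n (c : Config d h) → total h (replicate n c) ≡ n · pebbles h c
  total-replicate zero    c = refl
  total-replicate (suc n) c = cong (pebbles h c +_) (total-replicate n c)

  -- The trees are processed one after another: the current one stays within `q`, and each of the
  -- other `n`, finished or untouched, holds at most `x`.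
  each : ∀ n {q x} {c c' : Config d h} → pebbles h c ≤ x → pebbles h c' ≤ x → Path h q c c' →
         ForestPath h (q + n · x) (replicate (suc n) c) (replicate (suc n) c')
  each zero    c≤x c'≤x p = on-head [] ≤-refl p
  each (suc n) {q} {x} {c} c≤x c'≤x p =
    on-head (all-replicate (suc n) (proj₁ (start p)))
            (+-monoʳ-≤ q (≤-trans (≤-reflexive (total-replicate (suc n) c)) (·-mono (suc n) c≤x))) p
    ⊳ on-tail (proj₁ (end p))
              (≤-trans (+-monoˡ-≤ _ c'≤x) (≤-reflexive (shuffle x q (n · x))))
              (each n c≤x c'≤x p)
    where
    shuffle : ∀ a b c → a + (b + c) ≡ b + (a + c)
    shuffle = solve-∀ ring

valid-empty : ∀ d h → Valid h (empty d h)
valid-empty d zero    = tt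
valid-empty d (suc h) = (≤-refl , ≤-refl , 0≤1) , all-replicate d (valid-empty d h)

pebbles-empty : ∀ d h → pebbles h (empty d h) ≡ 0ℚ
total-empty : ∀ d h n → total h (replicate n (empty d h)) ≡ 0ℚ
pebbles-empty d zero    = refl
pebbles-empty d (suc h) = trans (+-identityˡ _) (total-empty d h d)
total-empty d h zero    = refl
total-empty d h (suc n) = cong₂ _+_ (pebbles-empty d h) (total-empty d h n)

-- The half-pebble strategy.

module Strategy (n : ℕ) where

  d : ℕ
  d = suc (suc n)

  κ : ℚ
  κ = suc n · ½

  -- As `κ` is (d-1)/2, this is the upper bound (d-1)h/2 + 1 for the tree with `h` levels.
  budget : ℕ → ℚ
  budget h = 1ℚ + h · κ

  0≤½ : 0ℚ ≤ ½
  0≤½ = nonNegative⁻¹ ½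

  0≤κ : 0ℚ ≤ κ
  0≤κ = ·-nonneg (suc n) 0≤½

  ½≤1 : ½ ≤ 1ℚ
  ½≤1 = +-monoʳ-≤ ½ 0≤½

  sole : ∀ {h} → Val → Config d (suc h)
  sole {h} v = v , replicate d (empty d h)

  valid-sole : ∀ {h v} → ValidVal v → Valid (suc h) (sole v)
  valid-sole {h} vv = vv , all-replicate d (valid-empty d h)

  pebbles-sole : ∀ {h} v → pebbles (suc h) (sole {h} v) ≡ pval v
  pebbles-sole {h} v = trans (cong (pval v +_) (total-empty d h d)) (+-identityʳ (pval v))

  -- The forests of children just before and just after the root is pebbled.
  -- The first child is pebbled last, with its own leftover white pebbles still
  -- to be removed; every other child is half black and half white.
  pre post : ∀ h → Vec (Config d h) d
  post zero    = replicate d tt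
  post (suc h) = ((0ℚ , 0ℚ) , post h) ∷ replicate (suc n) (sole (0ℚ , ½))
  pre zero    = replicate d tt
  pre (suc h) = ((1ℚ , 0ℚ) , post h) ∷ replicate (suc n) (sole (½ , ½))

  black½ : ValidVal (½ , 0ℚ)
  black½ = 0≤½ , ≤-refl , ½≤1

  white½ : ValidVal (0ℚ , ½)
  white½ = ≤-refl , 0≤½ , ½≤1

  blank : ValidVal (0ℚ , 0ℚ)
  blank = ≤-refl , ≤-refl , 0≤1

  black1 : ValidVal (1ℚ , 0ℚ)
  black1 = 0≤1 , ≤-refl , ≤-refl

  all-full : ∀ h → VAll.All (RootFull h) (pre h)
  all-full zero    = full d
    where
    full : ∀ n → VAll.All (RootFull {d} zero) (replicate n tt)
    full zero    = []
    full (suc n) = tt ∷ full n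
  all-full (suc h) = refl ∷ full (suc n)
    where
    full : ∀ n → VAll.All (RootFull (suc h)) (replicate n (sole (½ , ½)))
    full zero    = []
    full (suc n) = refl ∷ full n

  dec : ∀ h k → RootBlackDec h (lookup (pre h) k) (lookup (post h) k)
  dec zero    k       = tt
  dec (suc h) zero    = 0≤1 , refl , refl
  dec (suc h) (suc k) = subst₂ (RootBlackDec (suc h))
    (sym (lookup-replicate k (sole (½ , ½)))) (sym (lookup-replicate k (sole (0ℚ , ½))))
    (0≤½ , refl , refl)

  valid-post : ∀ h → VAll.All (Valid h) (post h)
  valid-post zero    = all-replicate {d} {zero} d tt
  valid-post (suc h) = (blank , valid-post h) ∷ all-replicate (suc n) (valid-sole white½)

  total-sole : ∀ h v → total (suc h) (replicate (suc n) (sole {h} v)) ≡ suc n · pval v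
  total-sole h v = trans (total-replicate (suc n) (sole {h} v)) (cong (suc n ·_) (pebbles-sole {h} v))

  -- On each level white ½ remains on `d-1` siblings, which makes `κ`.
  total-post : ∀ h → total h (post h) ≡ h · κ
  total-post zero    = total-empty d zero d
  total-post (suc h) =
    trans (cong₂ _+_ (trans (+-identityˡ (total h (post h))) (total-post h)) (total-sole h (0ℚ , ½)))
          (+-comm (h · κ) κ)

  fire : ∀ {h w b} → 0ℚ ≤ b → Move (suc h) ((0ℚ , w) , pre h) ((b , 0ℚ) , post h)
  fire {h} 0≤b = place (all-full h) 0≤b (dec h)

  fits : ∀ h → 1ℚ + total h (post h) ≤ budget (suc h)
  fits h = ≤-trans (≤-reflexive (cong (1ℚ +_) (total-post h)))
                   (lin 0≤κ (arrange (h · κ) κ))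
    where
    arrange : ∀ a b → 1ℚ + a + b ≡ 1ℚ + (b + a) + 0ℚ
    arrange = solve-∀ ring

  -- Mutually recursive, because setting or clearing half a pebble on a child takes a complete `fwd`
  -- and `bwd` on the forest below that child.
  fwd : ∀ h → ForestPath h (budget (suc h)) (replicate d (empty d h)) (pre h)
  bwd : ∀ h → ForestPath h (budget (suc h)) (post h) (replicate d (empty d h))

  ready : ∀ h → Path (suc h) (budget (suc h)) (empty d (suc h)) ((1ℚ , 0ℚ) , post h)
  ready h = under blank (≤-reflexive (+-identityˡ _)) (fwd h)
            ⊳[ fire 0≤1 ] stop ((black1 , valid-post h) , fits h)

  reset : ∀ h → Path (suc h) (budget (suc h)) ((0ℚ , 0ℚ) , post h) (empty d (suc h))
  reset h = under blank (≤-reflexive (+-identityˡ _)) (bwd h)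

  set½ : ∀ h → Path (suc h) (budget (suc h) + ½) (sole (0ℚ , 0ℚ)) (sole (½ , 0ℚ))
  set½ h = under blank (lin 0≤½ (arrange (budget (suc h)) ½)) (fwd h)
           ⊳[ fire 0≤½ ] under black½ (≤-reflexive (+-comm ½ (budget (suc h)))) (bwd h)
    where
    arrange : ∀ b x → 0ℚ + b + x ≡ b + x + 0ℚ
    arrange = solve-∀ ring

  clear½ : ∀ h → Path (suc h) (budget (suc h) + ½) (sole (0ℚ , ½)) (sole (0ℚ , 0ℚ))
  clear½ h = under white½ (≤-reflexive (+-comm ½ (budget (suc h)))) (fwd h)
             ⊳[ fire ≤-refl ] under blank (lin 0≤½ (arrange (budget (suc h)) ½)) (bwd h)
    where
    arrange : ∀ b x → 0ℚ + b + x ≡ b + x + 0ℚ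
    arrange = solve-∀ ring

  add½ : ∀ h → Path (suc h) 1ℚ (sole (½ , 0ℚ)) (sole (½ , ½))
  add½ h = step (valid-sole black½ , ≤-trans (≤-reflexive (pebbles-sole {h} (½ , 0ℚ))) ½≤1)
                (incWhite 0≤½)
                (stop (valid-sole (0≤½ , 0≤½ , ≤-refl) , ≤-reflexive (pebbles-sole {h} (½ , ½))))

  private
    sole≤ : ∀ {h} v {x} → pval v ≤ x → pebbles (suc h) (sole {h} v) ≤ x
    sole≤ {h} v le = ≤-trans (≤-reflexive (pebbles-sole {h} v)) le

    two : ∀ h → budget (suc h) + ½ + n · ½ ≡ budget (suc (suc h))
    two h = arrange (h · κ) ½ (n · ½)
      where
      arrange : ∀ a x y → 1ℚ + (x + y + a) + x + y ≡ 1ℚ + (x + y + (x + y + a))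
      arrange = solve-∀ ring

    one : ∀ h → budget (suc h) + suc n · ½ ≡ budget (suc (suc h))
    one h = trans (sym (+-assoc (budget (suc h)) ½ (n · ½))) (two h)

  fwd zero    = stop (all-replicate {d} {zero} d tt , ≤-trans (≤-reflexive (total-empty d zero d))
                                             (+-mono-≤ 0≤1 (·-nonneg 1 {κ} 0≤κ)))
  fwd (suc h) =
    on-tail (valid-sole blank)
            (≤-reflexive (trans (cong (_+ (budget (suc h) + ½ + n · ½)) (pebbles-sole {h} (0ℚ , 0ℚ)))
                                (trans (+-identityˡ _) (two h))))
            (each n (sole≤ {h} (0ℚ , 0ℚ) 0≤½) (sole≤ {h} (½ , 0ℚ) ≤-refl) (set½ h))
    ⊳ on-head (all-replicate (suc n) (valid-sole black½))
              (≤-reflexive (trans (cong (budget (suc h) +_) (total-sole h (½ , 0ℚ))) (one h)))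
              (ready h)
    -- The budget is met exactly here: the roots of the `d` trees hold `d = 1 + κ + κ`, and `h · κ`
    -- is left below the first.
    ⊳ on-tail (black1 , valid-post h)
              (≤-reflexive (trans (cong (λ x → 1ℚ + x + (1ℚ + n · 1ℚ)) (total-post h))
                           (trans (cong (λ x → 1ℚ + h · κ + (1ℚ + x)) (sym (·-double n ½)))
                                  (arrange (h · κ) ½ (n · ½)))))
              (each n (sole≤ {h} (½ , 0ℚ) ½≤1) (sole≤ {h} (½ , ½) ≤-refl) (add½ h))
    where
    arrange : ∀ a x y → 1ℚ + a + (x + x + (y + y)) ≡ 1ℚ + (x + y + (x + y + a))
    arrange = solve-∀ ring

  bwd zero    = stop (all-replicate {d} {zero} d tt , ≤-trans (≤-reflexive (total-empty d zero d))
                                             (+-mono-≤ 0≤1 (·-nonneg 1 {κ} 0≤κ)))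
  bwd (suc h) =
    on-head (all-replicate (suc n) (valid-sole white½))
            (≤-reflexive (trans (cong (budget (suc h) +_) (total-sole h (0ℚ , ½))) (one h)))
            (reset h)
    ⊳ on-tail (valid-sole blank)
              (≤-reflexive (trans (cong (_+ (budget (suc h) + ½ + n · ½)) (pebbles-sole {h} (0ℚ , 0ℚ)))
                                  (trans (+-identityˡ _) (two h))))
              (each n (sole≤ {h} (0ℚ , ½) ≤-refl) (sole≤ {h} (0ℚ , 0ℚ) 0≤½) (clear½ h))

  strategy : ∀ h → FracPebbling d (suc h) (budget (suc h))
  strategy h = fromPaths (ready h) refl
    -- Giving up the black pebble on the root first frees the whole budget for clearing `post h`.
    (step (end (ready h)) (decBlack 0≤1) (reset h))

-- General lower bound

min : ∀ {n} → (Fin (suc n) → ℕ) → ℕ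
min {zero}  f = f zero
min {suc n} f = f zero ⊓ min (f ∘ suc)

min-≤ : ∀ {n} (f : Fin (suc n) → ℕ) k → min f ℕ.≤ f k
min-≤ {zero}  f zero    = ℕ.≤-refl
min-≤ {suc n} f zero    = ℕ.m⊓n≤m _ _
min-≤ {suc n} f (suc k) = ℕ.≤-trans (ℕ.m⊓n≤n (f zero) _) (min-≤ (f ∘ suc) k)

min-attained : ∀ {n} (f : Fin (suc n) → ℕ) → Σ (Fin (suc n)) λ k → min f ≡ f k
min-attained {zero}  f = zero , refl
min-attained {suc n} f with ℕ.⊓-sel (f zero) (min (f ∘ suc)) | min-attained (f ∘ suc)
... | inj₁ eq | _      = zero , eq
... | inj₂ eq | k , e  = suc k , trans eq e

-- The contribution of weight x on level i to the total weight on levels ≥ j.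
ind : ℕ → ℕ → ℚ → ℚ
ind zero    i       x = x
ind (suc j) zero    x = 0ℚ
ind (suc j) (suc i) x = ind j i x

ind-mono : ∀ j i {x y} → x ≤ y → ind j i x ≤ ind j i y
ind-mono zero    i       x≤y = x≤y
ind-mono (suc j) zero    x≤y = ≤-refl
ind-mono (suc j) (suc i) x≤y = ind-mono j i x≤y

ind-+ : ∀ j i x y → ind j i (x + y) ≡ ind j i x + ind j i y
ind-+ zero    i       x y = refl
ind-+ (suc j) zero    x y = refl
ind-+ (suc j) (suc i) x y = ind-+ j i x y

ind-0 : ∀ j i → ind j i 0ℚ ≡ 0ℚ
ind-0 zero    i       = refl
ind-0 (suc j) zero    = refl
ind-0 (suc j) (suc i) = ind-0 j i

ind-nonneg : ∀ j i {x} → 0ℚ ≤ x → 0ℚ ≤ ind j i x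
ind-nonneg j i {x} 0≤x = ≤-trans (≤-reflexive (sym (ind-0 j i))) (ind-mono j i 0≤x)

ind-anti : ∀ {l j} i {x} → 0ℚ ≤ x → l ℕ.≤ j → ind j i x ≤ ind l i x
ind-anti {l} {zero}  i       0≤x z≤n       = ≤-refl
ind-anti {l} {suc j} zero    0≤x z≤n       = 0≤x
ind-anti {l} {suc j} (suc i) 0≤x z≤n       = ind-anti {zero} {j} i 0≤x z≤n
ind-anti             zero    0≤x (s≤s l≤j) = ≤-refl
ind-anti             (suc i) 0≤x (s≤s l≤j) = ind-anti i 0≤x l≤j

ind-in : ∀ {j i} x → j ℕ.≤ i → ind j i x ≡ x
ind-in x z≤n       = refl
ind-in x (s≤s j≤i) = ind-in x j≤i

ind-out : ∀ {j i} x → i ℕ.< j → ind j i x ≡ 0ℚ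
ind-out {suc j} {zero}  x _         = refl
ind-out {suc j} {suc i} x (s≤s i<j) = ind-out x i<j

-- Charging labels and their weight profiles.

module Potential (n : ℕ) where

  d : ℕ
  d = suc n

  K : ℚ
  K = n · 1ℚ

  0≤K : 0ℚ ≤ K
  0≤K = ·-nonneg n 0≤1

  -- Levels are counted from the leaves, which have level 0 and carry no charge.
  -- A label determines the extra weight of a node: b for paid (the black value
  -- is charged to the node itself), 1 - w for full (a frontier node), 0 for cov
  -- (the black value is charged to a frontier below) and inner (a node above the
  -- frontier).
  data Free : ℕ → Set
  data Blk  : ℕ → Set

  data Free where
    leaf : Free 0
    paid : ∀ {i} → (Fin d → Free i) → Free (suc i)
    cov  : ∀ {i} → (Fin d → Blk i) → Free (suc i)

  data Blk where
    full  : ∀ {i} → (Fin d → Free i) → Blk (suc i)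
    inner : ∀ {i} → (Fin d → Blk i) → Blk (suc i)

  -- The profile of a labelling: its extra weight on levels at least `j`, as a function of `j`.
  profF : ∀ {i} → Free i → Config d (suc i) → ℕ → ℚ
  profB : ∀ {i} → Blk i → Config d (suc i) → ℕ → ℚ
  profF leaf _ j = 0ℚ
  profF (paid {i} f) ((b , w) , cs) j = ind j (suc i) b + ∑ (λ k → profF (f k) (lookup cs k) j)
  profF (cov s)      (v , cs)       j = ∑ (λ k → profB (s k) (lookup cs k) j)
  profB (full {i} f) ((b , w) , cs) j = ind j (suc i) (1ℚ - w) + ∑ (λ k → profF (f k) (lookup cs k) j)
  profB (inner s)    (v , cs)       j = ∑ (λ k → profB (s k) (lookup cs k) j)

  w≤1 : ∀ {b w} → ValidVal (b , w) → 0ℚ ≤ 1ℚ - w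
  w≤1 {b} {w} (0≤b , _ , b+w≤1) = lin (+-mono-≤ 0≤b b+w≤1) (arrange b w)
    where
    arrange : ∀ b w → 0ℚ + (b + 1ℚ) ≡ 1ℚ - w + (0ℚ + (b + w))
    arrange = solve-∀ ring

  profF-nonneg : ∀ {i} (S : Free i) c → Valid (suc i) c → ∀ j → 0ℚ ≤ profF S c j
  profB-nonneg : ∀ {i} (S : Blk i) c → Valid (suc i) c → ∀ j → 0ℚ ≤ profB S c j
  profF-nonneg leaf     c        v        j = ≤-refl
  profF-nonneg (paid f) (_ , cs) (vv , v) j =
    +-mono-≤ (ind-nonneg j _ (proj₁ vv)) (∑-nonneg (λ k → profF-nonneg (f k) (lookup cs k) (child v k) j))
  profF-nonneg (cov s)  (_ , cs) (vv , v) j = ∑-nonneg (λ k → profB-nonneg (s k) (lookup cs k) (child v k) j)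
  profB-nonneg (full f) (_ , cs) (vv , v) j =
    +-mono-≤ (ind-nonneg j _ (w≤1 vv)) (∑-nonneg (λ k → profF-nonneg (f k) (lookup cs k) (child v k) j))
  profB-nonneg (inner s)  (_ , cs) (vv , v) j = ∑-nonneg (λ k → profB-nonneg (s k) (lookup cs k) (child v k) j)

  Antitone : (ℕ → ℚ) → Set
  Antitone f = ∀ {l j} → l ℕ.≤ j → f j ≤ f l

  profF-anti : ∀ {i} (S : Free i) c → Valid (suc i) c → Antitone (profF S c)
  profB-anti : ∀ {i} (S : Blk i) c → Valid (suc i) c → Antitone (profB S c)
  profF-anti leaf     c        v        l≤j = ≤-refl
  profF-anti (paid f) (_ , cs) (vv , v) l≤j =
    +-mono-≤ (ind-anti _ (proj₁ vv) l≤j) (∑-mono (λ k → profF-anti (f k) (lookup cs k) (child v k) l≤j))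
  profF-anti (cov s)  (_ , cs) (vv , v) l≤j = ∑-mono (λ k → profB-anti (s k) (lookup cs k) (child v k) l≤j)
  profB-anti (full f) (_ , cs) (vv , v) l≤j =
    +-mono-≤ (ind-anti _ (w≤1 vv) l≤j) (∑-mono (λ k → profF-anti (f k) (lookup cs k) (child v k) l≤j))
  profB-anti (inner s)  (_ , cs) (vv , v) l≤j = ∑-mono (λ k → profB-anti (s k) (lookup cs k) (child v k) l≤j)

  profF-above : ∀ {i} (S : Free i) c {j} → i ℕ.< j → profF S c j ≤ 0ℚ
  profB-above : ∀ {i} (S : Blk i) c {j} → i ℕ.< j → profB S c j ≤ 0ℚ
  profF-above leaf     c        i<j = ≤-refl
  profF-above (paid f) ((b , w) , cs) i<j =
    +-mono-≤ (≤-reflexive (ind-out b i<j))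
             (∑-nonpos (λ k → profF-above (f k) (lookup cs k) (ℕ.<-trans (ℕ.n<1+n _) i<j)))
  profF-above (cov s)  (v , cs) i<j = ∑-nonpos (λ k → profB-above (s k) (lookup cs k) (ℕ.<-trans (ℕ.n<1+n _) i<j))
  profB-above (full f) ((b , w) , cs) i<j =
    +-mono-≤ (≤-reflexive (ind-out (1ℚ - w) i<j))
             (∑-nonpos (λ k → profF-above (f k) (lookup cs k) (ℕ.<-trans (ℕ.n<1+n _) i<j)))
  profB-above (inner s)  (v , cs) i<j = ∑-nonpos (λ k → profB-above (s k) (lookup cs k) (ℕ.<-trans (ℕ.n<1+n _) i<j))

  -- Frontiers and normal labellings.

  wt : ∀ i → Config d (suc i) → ℚ
  wt zero    _        = 0ℚ
  wt (suc i) (v , cs) = pval v + ∑ (λ k → wt i (lookup cs k))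

  -- For the part of the tree above and on the frontier, the extra weight on the
  -- frontier minus the pebbles found there; N counts the frontier nodes.
  F : ∀ {i} → Blk i → Config d (suc i) → ℚ
  F (full f)  ((b , w) , cs) = 1ℚ - w - w - b
  F (inner s) ((b , w) , cs) = ∑ (λ k → F (s k) (lookup cs k)) - (b + w)

  N : ∀ {i} → Blk i → ℚ
  N (full f)  = 1ℚ
  N (inner s) = ∑ (λ k → N (s k))

  low : ∀ {i} → Blk i → ℕ
  low (full {i} f) = suc i
  low (inner s)    = min (λ k → low (s k))

  demote : ∀ {i} → Blk i → Free i
  demote (full f)  = paid f
  demote (inner s) = paid (λ k → demote (s k))

  low≤ : ∀ {i} (S : Blk i) → low S ℕ.≤ i
  low≤ (full f)  = ℕ.≤-refl
  low≤ (inner s) = ℕ.≤-trans (min-≤ (λ k → low (s k)) zero) (ℕ.m≤n⇒m≤1+n (low≤ (s zero)))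

  1≤N : ∀ {i} (S : Blk i) → 1ℚ ≤ N S
  1≤N (full f)  = ≤-refl
  1≤N (inner s) = ≤-trans (1≤N (s zero)) (∑-≥ {f = λ k → N (s k)} zero (λ k → ≤-trans 0≤1 (1≤N (s k))))

  -- Descend towards a lowest frontier node: at each level passed, the `d-1` other children
  -- contribute at least one frontier node each, hence one `K` per level.
  N-low : ∀ {i} (S : Blk i) → 1ℚ + i · K ≤ N S + low S · K
  N-low (full f)  = ≤-refl
  N-low (inner {i} s) with min-attained (λ k → low (s k))
  ... | k , eq rewrite eq =
    lin (+-mono-≤ (∑-pick {f = λ k → N (s k)} {g = λ _ → 1ℚ} k (λ k → 1≤N (s k))) (N-low (s k)))
        (trans (arrange K (i · K) (∑ (λ k → N (s k))) (N (s k)) (low (s k) · K))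
               (cong (λ z → ∑ (λ k → N (s k)) + low (s k) · K + (N (s k) + z + (1ℚ + i · K)))
                     (sym (∑-const d 1ℚ))))
    where
    arrange : ∀ K iK S N lK → 1ℚ + (K + iK) + (S + 1ℚ + (N + lK)) ≡ S + lK + (N + (1ℚ + K) + (1ℚ + iK))
    arrange = solve-∀ ring

  -- No frontier carries more extra weight than it would after being moved up.
  NormF : ∀ {i} → Free i → Config d (suc i) → Set
  NormB : ∀ {i} → Blk i → Config d (suc i) → Set
  NormF leaf      _              = ⊤
  NormF (paid f)  (v , cs)       = ∀ k → NormF (f k) (lookup cs k)
  NormF (cov s)   ((b , w) , cs) = (∀ k → NormB (s k) (lookup cs k)) × ∑ (λ k → F (s k) (lookup cs k)) ≤ b + w
  NormB (full f)  (v , cs)       = ∀ k → NormF (f k) (lookup cs k)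
  NormB (inner s) ((b , w) , cs) =
    (∀ k → NormB (s k) (lookup cs k)) × F (inner s) ((b , w) , cs) ≤ 1ℚ - w - w - b

  normF-demote : ∀ {i} (S : Blk i) c → NormB S c → NormF (demote S) c
  normF-demote (full f)  (v , cs) nrm       = nrm
  normF-demote (inner s) (v , cs) (nrm , _) = λ k → normF-demote (s k) (lookup cs k) (nrm k)

  -- `F` is what a frontier carries beyond the pebbles down to it; below a covered node, normality
  -- lets the pebbles on that node absorb this excess.
  sizeF : ∀ {i} (S : Free i) c → Valid (suc i) c → NormF S c → profF S c 0 ≤ wt i c
  sizeB : ∀ {i} (S : Blk i) c → Valid (suc i) c → NormB S c → profB S c 0 ≤ wt i c + F S c
  sizeF leaf     c v nrm = ≤-refl
  sizeF (paid {i} f) ((b , w) , cs) ((0≤b , 0≤w , _) , v) nrm =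
    lin (+-mono-≤ 0≤w (∑-mono (λ k → sizeF (f k) (lookup cs k) (child v k) (nrm k))))
        (arrange b w _ _)
    where
    arrange : ∀ b w P W → b + P + (w + W) ≡ b + w + W + (0ℚ + P)
    arrange = solve-∀ ring
  sizeF (cov {i} s) ((b , w) , cs) (_ , v) (nrm , le) =
    lin (+-mono-≤ (∑-mono (λ k → sizeB (s k) (lookup cs k) (child v k) (nrm k))) le)
        (trans (cong (λ z → P + (z + (b + w))) (∑-+ (λ k → wt i (lookup cs k)) (λ k → F (s k) (lookup cs k))))
               (arrange b w P (∑ (λ k → wt i (lookup cs k))) (∑ (λ k → F (s k) (lookup cs k)))))
    where
    P = ∑ (λ k → profB (s k) (lookup cs k) 0)
    arrange : ∀ b w P W F → P + (W + F + (b + w)) ≡ b + w + W + (P + F)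
    arrange = solve-∀ ring
  sizeB (full {i} f) ((b , w) , cs) ((0≤b , 0≤w , _) , v) nrm =
    lin (∑-mono (λ k → sizeF (f k) (lookup cs k) (child v k) (nrm k)))
        (arrange b w _ _)
    where
    arrange : ∀ b w P W → 1ℚ - w + P + W ≡ b + w + W + (1ℚ - w - w - b) + P
    arrange = solve-∀ ring
  sizeB (inner {i} s) ((b , w) , cs) (_ , v) (nrm , _) =
    lin (∑-mono (λ k → sizeB (s k) (lookup cs k) (child v k) (nrm k)))
        (trans (cong (λ z → P + z) (∑-+ (λ k → wt i (lookup cs k)) (λ k → F (s k) (lookup cs k))))
               (arrange b w P (∑ (λ k → wt i (lookup cs k))) (∑ (λ k → F (s k) (lookup cs k)))))
    where
    P = ∑ (λ k → profB (s k) (lookup cs k) 0)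
    arrange : ∀ b w P W F → P + (W + F) ≡ b + w + W + (F - (b + w)) + P
    arrange = solve-∀ ring

  F≤ : ∀ {i} (S : Blk (suc i)) b w cs → NormB S ((b , w) , cs) → F S ((b , w) , cs) ≤ 1ℚ - w - w - b
  F≤ (full f)  b w cs nrm      = ≤-refl
  F≤ (inner s) b w cs (_ , le) = le

  module _ {i} (s : Fin d → Blk i) (cs : Vec (Config d (suc i)) d) where

    ∑P : ℕ → ℚ
    ∑P l = ∑ (λ k → profB (s k) (lookup cs k) l)

    ∑D : ℕ → ℚ
    ∑D j = ∑ (λ k → profF (demote (s k)) (lookup cs k) j)

    ∑F : ℚ
    ∑F = ∑ (λ k → F (s k) (lookup cs k))

    ∑N : ℚ
    ∑N = ∑ (λ k → N (s k))

    lowest : ℕ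
    lowest = min (λ k → low (s k))

    lowest<1+i : lowest ℕ.< suc i
    lowest<1+i = s≤s (ℕ.≤-trans (min-≤ (λ k → low (s k)) zero) (low≤ (s zero)))

  -- A frontier node satisfies `1 + (1 - w - w - b) ≤ 2 (1 - w)`, inner nodes only lower `F`, and
  -- `l ≤ low S` makes the whole frontier count.
  blocking : ∀ {i} (S : Blk i) c → Valid (suc i) c → ∀ {l} → l ℕ.≤ low S →
             N S + F S c ≤ profB S c l + profB S c l
  ∑-blocking : ∀ {i} (s : Fin d → Blk i) cs → VAll.All (Valid (suc i)) cs → ∀ {l} → l ℕ.≤ lowest s cs →
               ∑N s cs + ∑F s cs ≤ ∑P s cs l + ∑P s cs l
  ∑-blocking s cs v {l} l≤ =
    subst₂ _≤_ (∑-+ (λ k → N (s k)) (λ k → F (s k) (lookup cs k)))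
               (∑-+ (λ k → profB (s k) (lookup cs k) l) (λ k → profB (s k) (lookup cs k) l))
      (∑-mono (λ k → blocking (s k) (lookup cs k) (child v k)
                       (ℕ.≤-trans l≤ (min-≤ (λ k → low (s k)) k))))
  blocking (full {i} f) ((b , w) , cs) ((0≤b , _) , v) {l} l≤ rewrite ind-in (1ℚ - w) l≤ =
    lin (+-mono-≤ 0≤b (+-mono-≤ 0≤P 0≤P)) (arrange b w (∑ (λ k → profF (f k) (lookup cs k) l)))
    where
    0≤P = ∑-nonneg (λ k → profF-nonneg (f k) (lookup cs k) (child v k) l)
    arrange : ∀ b w P → 1ℚ + (1ℚ - w - w - b) + (b + (P + P)) ≡ 1ℚ - w + P + (1ℚ - w + P) + (0ℚ + (0ℚ + 0ℚ))
    arrange = solve-∀ ring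
  blocking (inner s) ((b , w) , cs) ((0≤b , 0≤w , _) , v) {l} l≤ =
    lin (+-mono-≤ (∑-blocking s cs v l≤) (+-mono-≤ 0≤b 0≤w))
        (arrange b w (∑N s cs) (∑F s cs) (∑P s cs l))
    where
    arrange : ∀ b w N F P → N + (F - (b + w)) + (P + P + (b + w)) ≡ P + P + (N + F + (0ℚ + 0ℚ))
    arrange = solve-∀ ring

  -- Replacing the blocking frontier of S by the black pebbles above it moves
  -- weight upwards; each of the j ∸ low S levels gained is worth K.
  demotion : ∀ {i} (S : Blk i) c → Valid (suc i) c → NormB S c → ∀ {l j} →
             j ℕ.≤ i → l ℕ.≤ j → l ℕ.≤ low S →
             profF (demote S) c j + profF (demote S) c j + (F S c + F S c) + (j ∸ low S) · K
               ≤ profB S c l + profB S c l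
  ∑-demotion : ∀ {i} (s : Fin d → Blk i) cs → VAll.All (Valid (suc i)) cs →
               (∀ k → NormB (s k) (lookup cs k)) → ∀ {l j} →
               j ℕ.≤ i → l ℕ.≤ j → l ℕ.≤ lowest s cs →
               ∑D s cs j + ∑D s cs j + (∑F s cs + ∑F s cs) + (j ∸ lowest s cs) · K
                 ≤ ∑P s cs l + ∑P s cs l
  ∑-demotion {i} s cs v nrm {l} {j} j≤i l≤j l≤ with min-attained (λ k → low (s k))
  ... | k₀ , eq =
    ≤-trans (+-monoʳ-≤ (∑ D + ∑ D + (∑ G + ∑ G)) e₀≤)
      (subst₂ _≤_ (trans (∑-+ (λ k → D k + D k + (G k + G k)) e)
                         (cong (_+ ∑ e) (trans (∑-+ (λ k → D k + D k) (λ k → G k + G k))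
                                               (cong₂ _+_ (∑-+ D D) (∑-+ G G)))))
                  (∑-+ P P) sums)
    where
    D G e P : Fin d → ℚ
    D k = profF (demote (s k)) (lookup cs k) j
    G k = F (s k) (lookup cs k)
    e k = (j ∸ low (s k)) · K
    P k = profB (s k) (lookup cs k) l
    -- A child whose frontier reaches lowest supplies the whole gain by itself.
    e₀≤ : (j ∸ lowest s cs) · K ≤ ∑ e
    e₀≤ = ≤-trans (≤-reflexive (cong (λ x → (j ∸ x) · K) eq))
                  (∑-≥ {f = e} k₀ (λ k → ·-nonneg (j ∸ low (s k)) 0≤K))
    sums : ∑ (λ k → D k + D k + (G k + G k) + e k) ≤ ∑ (λ k → P k + P k)
    sums = ∑-mono (λ k → demotion (s k) (lookup cs k) (child v k) (nrm k) j≤i l≤j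
                           (ℕ.≤-trans l≤ (min-≤ (λ k → low (s k)) k)))
  demotion (full {i} f) ((b , w) , cs) ((0≤b , 0≤w , _) , v) nrm {l} {j} j≤i l≤j l≤
    rewrite ind-in b j≤i | ind-in (1ℚ - w) l≤ | ℕ.m≤n⇒m∸n≡0 j≤i =
    lin (+-mono-≤ (+-mono-≤ anti anti) (+-mono-≤ 0≤w 0≤w))
        (arrange b w (∑ (λ k → profF (f k) (lookup cs k) j)) (∑ (λ k → profF (f k) (lookup cs k) l)))
    where
    anti = ∑-mono (λ k → profF-anti (f k) (lookup cs k) (child v k) l≤j)
    arrange : ∀ b w Q P →
      b + Q + (b + Q) + (1ℚ - w - w - b + (1ℚ - w - w - b)) + 0ℚ + (P + P + (w + w))
        ≡ 1ℚ - w + P + (1ℚ - w + P) + (Q + Q + (0ℚ + 0ℚ))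
    arrange = solve-∀ ring
  demotion (inner {i} s) ((b , w) , cs) ((0≤b , 0≤w , _) , v) (nrm , F≤) {l} {j} j≤i l≤j l≤
    rewrite ind-in b j≤i with ℕ.m≤n⇒m<n∨m≡n j≤i
  -- Below the level of the node, its newly charged `b` is offset by the `b + w` subtracted in `F`.
  ... | inj₁ (s≤s j<i) =
    lin (+-mono-≤ (∑-demotion s cs v nrm j<i l≤j l≤) (+-mono-≤ 0≤w 0≤w))
        (arrange b w (∑D s cs j) (∑F s cs) ((j ∸ lowest s cs) · K) (∑P s cs l))
    where
    arrange : ∀ b w D F e P →
      b + D + (b + D) + (F - (b + w) + (F - (b + w))) + e + (P + P + (w + w))
        ≡ P + P + (D + D + (F + F) + e + (0ℚ + 0ℚ))
    arrange = solve-∀ ring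
  -- On the level of the node only `b` survives demotion. Normality bounds one copy of `F`, blocking
  -- the other, and the number of frontier nodes pays for the levels gained.
  ... | inj₂ refl =
    lin (+-mono-≤ (∑-blocking s cs v l≤)
        (+-mono-≤ (N-low (inner s))
        (+-mono-≤ F≤
        (+-mono-≤ (≤-reflexive gap)
        (+-mono-≤ (+-mono-≤ D≤0 D≤0)
        (+-mono-≤ 0≤w (+-mono-≤ 0≤w 0≤w)))))))
        (arrange b w (∑D s cs (suc i)) (∑F s cs) ((suc i ∸ lowest s cs) · K) (∑P s cs l)
                 (∑N s cs) (lowest s cs · K) (suc i · K))
    where
    D≤0 : ∑D s cs (suc i) ≤ 0ℚ
    D≤0 = ∑-nonpos (λ k → profF-above (demote (s k)) (lookup cs k) (ℕ.n<1+n i))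
    gap : (suc i ∸ lowest s cs) · K + lowest s cs · K ≡ suc i · K
    gap = trans (sym (·-distrib-+ (suc i ∸ lowest s cs) (lowest s cs) K))
                (cong (_· K) (ℕ.m∸n+n≡m (ℕ.<⇒≤ (lowest<1+i s cs))))
    arrange : ∀ b w D F e P N lK iK →
      b + D + (b + D) + (F - (b + w) + (F - (b + w))) + e
        + (P + P + (N + lK + (1ℚ - w - w - b + (iK + (0ℚ + 0ℚ + (w + (w + w)))))))
        ≡ P + P + (N + F + (1ℚ + iK + (F - (b + w) + (e + lK + (D + D + (0ℚ + (0ℚ + 0ℚ)))))))
    arrange = solve-∀ ring

  -- Comparison of profiles and normalisation.

  infix 4 _⊑_
  -- What is needed to carry the bounds `j · K + 2 f j ≤ M` over to `f'`: each follows from a bound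
  -- for `f` at some level `l`. Because `l ≤ j`, an antitone summand can be added on both sides.
  record _⊑_ (f' f : ℕ → ℚ) : Set where
    constructor by-level
    field
      level : ∀ j → Σ ℕ λ l → l ℕ.≤ j × j · K + (f' j + f' j) ≤ l · K + (f l + f l)
  open _⊑_

  ≤⇒⊑ : ∀ {f' f} → (∀ j → f' j ≤ f j) → f' ⊑ f
  ≤⇒⊑ le = by-level λ j → j , ℕ.≤-refl , +-monoʳ-≤ (j · K) (+-mono-≤ (le j) (le j))

  ⊑-trans : ∀ {f g h} → f ⊑ g → g ⊑ h → f ⊑ h
  ⊑-trans f⊑g g⊑h = by-level λ j →
    let l , l≤j , p = level f⊑g j
        m , m≤l , q = level g⊑h l
    in m , ℕ.≤-trans m≤l l≤j , ≤-trans p q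

  ⊑-frame : ∀ {f' f r} → Antitone r → f' ⊑ f → (λ j → r j + f' j) ⊑ (λ j → r j + f j)
  ⊑-frame {f'} {f} {r} anti f'⊑f = by-level λ j →
    let l , l≤j , p = level f'⊑f j
    in l , l≤j , lin (+-mono-≤ p (+-mono-≤ (anti l≤j) (anti l≤j)))
                     (arrange (j · K) (l · K) (f' j) (f l) (r j) (r l))
    where
    arrange : ∀ a b x y u v → a + (u + x + (u + x)) + (b + (y + y) + (v + v))
                                ≡ b + (v + y + (v + y)) + (a + (x + x) + (u + u))
    arrange = solve-∀ ring

  ⊑-resp : ∀ {f' f g' g} → (∀ j → g' j ≡ f' j) → (∀ j → f j ≡ g j) → f' ⊑ f → g' ⊑ g
  ⊑-resp e e' f'⊑f = ⊑-trans (≤⇒⊑ (λ j → ≤-reflexive (e j))) (⊑-trans f'⊑f (≤⇒⊑ (λ j → ≤-reflexive (e' j))))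

  -- Different summands may use different levels `l`, so they are exchanged one at a time, with the
  -- others as an antitone frame.
  ⊑-∑ : ∀ {m} {f' f : Fin m → ℕ → ℚ} → (∀ k → Antitone (f' k)) → (∀ k → Antitone (f k)) →
        (∀ k → f' k ⊑ f k) → (λ j → ∑ (λ k → f' k j)) ⊑ (λ j → ∑ (λ k → f k j))
  ⊑-∑ {zero}  _   _  _  = ≤⇒⊑ (λ _ → ≤-refl)
  ⊑-∑ {suc m} {f'} {f} a' a le =
    ⊑-trans (⊑-frame (a' zero) (⊑-∑ (a' ∘ suc) (a ∘ suc) (le ∘ suc)))
      (⊑-resp (λ j → +-comm (f' zero j) _) (λ j → +-comm _ (f zero j))
        (⊑-frame {r = λ j → ∑ (λ k → f (suc k) j)} (λ l≤j → ∑-mono (λ k → a (suc k) l≤j)) (le zero)))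

  -- Giving up the frontiers below a node puts weight `g` on that node. Their excess `∑F` pays for
  -- `g`, and the levels gained are paid for by `demotion` or by the number of frontier nodes.
  raise : ∀ {i} (s : Fin d → Blk i) cs → VAll.All (Valid (suc i)) cs →
          (∀ k → NormB (s k) (lookup cs k)) → ∀ {g} → g ≤ 1ℚ → g ≤ ∑F s cs →
          (λ j → ind j (suc i) g + ∑D s cs j) ⊑ ∑P s cs
  level (raise {i} s cs v nrm {g} g≤1 g≤F) j with ℕ.<-cmp j (suc i)
  -- The witness `lw ⊓ j` is the highest level up to `j` at which all frontier nodes still count.
  ... | tri< (s≤s j≤i) _ _ rewrite ind-in g (ℕ.m≤n⇒m≤1+n j≤i) =
    l , ℕ.m⊓n≤n lw j ,
    lin (+-mono-≤ (∑-demotion s cs v nrm j≤i (ℕ.m⊓n≤n lw j) (ℕ.m⊓n≤m lw j))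
        (+-mono-≤ (+-mono-≤ g≤F g≤F) (≤-reflexive gap)))
        (arrange g (j · K) (l · K) (∑D s cs j) (∑F s cs) ((j ∸ lw) · K) (∑P s cs l))
    where
    lw = lowest s cs
    l = lw ⊓ j
    gap : j · K ≡ l · K + (j ∸ lw) · K
    gap = trans (cong (_· K) (sym (ℕ.m⊓n+n∸m≡n lw j))) (·-distrib-+ l (j ∸ lw) K)
    arrange : ∀ g jK lK D F e P →
      jK + (g + D + (g + D)) + (P + P + (F + F + (lK + e)))
        ≡ lK + (P + P) + (D + D + (F + F) + e + (g + g + jK))
    arrange = solve-∀ ring
  -- One copy of `g` is bounded by 1, which `N-low` absorbs, and the other by the excess, which
  -- `∑-blocking` absorbs.
  ... | tri≈ _ refl _ rewrite ind-in g (ℕ.≤-refl {suc i}) =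
    lw , ℕ.<⇒≤ (lowest<1+i s cs) ,
    lin (+-mono-≤ (∑-blocking s cs v ℕ.≤-refl)
        (+-mono-≤ (N-low (inner s))
        (+-mono-≤ (+-mono-≤ g≤1 g≤F) (+-mono-≤ D≤0 D≤0))))
        (arrange g (suc i · K) (lw · K) (∑D s cs (suc i)) (∑F s cs) (∑P s cs lw) (∑N s cs))
    where
    lw = lowest s cs
    D≤0 : ∑D s cs (suc i) ≤ 0ℚ
    D≤0 = ∑-nonpos (λ k → profF-above (demote (s k)) (lookup cs k) (ℕ.n<1+n i))
    arrange : ∀ g jK lK D F P N →
      jK + (g + D + (g + D)) + (P + P + (N + lK + (1ℚ + F + (0ℚ + 0ℚ))))
        ≡ lK + (P + P) + (N + F + (1ℚ + jK + (g + g + (D + D))))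
    arrange = solve-∀ ring
  ... | tri> _ _ i<j rewrite ind-out g i<j =
    j , ℕ.≤-refl , +-monoʳ-≤ (j · K) (+-mono-≤ D≤P D≤P)
    where
    D≤P : 0ℚ + ∑D s cs j ≤ ∑P s cs j
    D≤P = ≤-trans (+-mono-≤ (≤-refl {0ℚ}) (∑-nonpos (λ k → profF-above (demote (s k)) (lookup cs k) (ℕ.<-trans (ℕ.n<1+n i) i<j))))
                  (∑-nonneg (λ k → profB-nonneg (s k) (lookup cs k) (child v k) j))

  -- Children come first. If the excess is then too large, `raise` makes a covered node paid, with
  -- `g = b`, and an inner node full, with `g = 1 - w`.
  normaliseF : ∀ {i} (S : Free i) c → Valid (suc i) c →
               Σ (Free i) λ S' → NormF S' c × profF S' c ⊑ profF S c
  normaliseB : ∀ {i} (S : Blk i) c → Valid (suc i) c →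
               Σ (Blk i) λ S' → NormB S' c × profB S' c ⊑ profB S c
  normaliseF leaf c v = leaf , tt , ≤⇒⊑ (λ _ → ≤-refl)
  normaliseF (paid {i} f) ((b , w) , cs) ((0≤b , _) , v) =
    paid (λ k → proj₁ (ch k)) , (λ k → proj₁ (proj₂ (ch k))) ,
    ⊑-frame {r = λ j → ind j (suc i) b} (ind-anti (suc i) 0≤b)
      (⊑-∑ (λ k → profF-anti (proj₁ (ch k)) (lookup cs k) (child v k))
           (λ k → profF-anti (f k) (lookup cs k) (child v k))
           (λ k → proj₂ (proj₂ (ch k))))
    where ch = λ k → normaliseF (f k) (lookup cs k) (child v k)
  normaliseF (cov {i} s) ((b , w) , cs) ((0≤b , 0≤w , b+w≤1) , v) = result
    where
    ch = λ k → normaliseB (s k) (lookup cs k) (child v k)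
    s' = λ k → proj₁ (ch k)
    nrm = λ k → proj₁ (proj₂ (ch k))
    s'⊑s : ∑P s' cs ⊑ ∑P s cs
    s'⊑s = ⊑-∑ (λ k → profB-anti (s' k) (lookup cs k) (child v k))
               (λ k → profB-anti (s k) (lookup cs k) (child v k))
               (λ k → proj₂ (proj₂ (ch k)))
    b≤b+w : b ≤ b + w
    b≤b+w = lin 0≤w (arrange b w)
      where
      arrange : ∀ b w → b + w ≡ b + w + 0ℚ
      arrange = solve-∀ ring
    result : Σ (Free (suc i)) λ S' → NormF S' ((b , w) , cs) × profF S' ((b , w) , cs) ⊑ ∑P s cs
    result with ≤-total (∑F s' cs) (b + w)
    ... | inj₁ le = cov s' , (nrm , le) , s'⊑s
    ... | inj₂ ge = paid (λ k → demote (s' k)) , (λ k → normF-demote (s' k) (lookup cs k) (nrm k)) ,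
                    ⊑-trans (raise s' cs v nrm {b} (≤-trans b≤b+w b+w≤1) (≤-trans b≤b+w ge)) s'⊑s
  normaliseB (full {i} f) ((b , w) , cs) (vv , v) =
    full (λ k → proj₁ (ch k)) , (λ k → proj₁ (proj₂ (ch k))) ,
    ⊑-frame {r = λ j → ind j (suc i) (1ℚ - w)} (ind-anti (suc i) (w≤1 vv))
      (⊑-∑ (λ k → profF-anti (proj₁ (ch k)) (lookup cs k) (child v k))
           (λ k → profF-anti (f k) (lookup cs k) (child v k))
           (λ k → proj₂ (proj₂ (ch k))))
    where ch = λ k → normaliseF (f k) (lookup cs k) (child v k)
  normaliseB (inner {i} s) ((b , w) , cs) ((0≤b , 0≤w , b+w≤1) , v) = result
    where
    ch = λ k → normaliseB (s k) (lookup cs k) (child v k)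
    s' = λ k → proj₁ (ch k)
    nrm = λ k → proj₁ (proj₂ (ch k))
    s'⊑s : ∑P s' cs ⊑ ∑P s cs
    s'⊑s = ⊑-∑ (λ k → profB-anti (s' k) (lookup cs k) (child v k))
               (λ k → profB-anti (s k) (lookup cs k) (child v k))
               (λ k → proj₂ (proj₂ (ch k)))
    result : Σ (Blk (suc i)) λ S' → NormB S' ((b , w) , cs) × profB S' ((b , w) , cs) ⊑ ∑P s cs
    result with ≤-total (∑F s' cs - (b + w)) (1ℚ - w - w - b)
    ... | inj₁ le = inner s' , (nrm , le) , s'⊑s
    ... | inj₂ ge = full (λ k → demote (s' k)) , (λ k → normF-demote (s' k) (lookup cs k) (nrm k)) ,
                    ⊑-trans (raise s' cs v nrm {1ℚ - w} (lin 0≤w (top w)) (lin ge (arrange b w (∑F s' cs)))) s'⊑s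
      where
      top : ∀ w → 1ℚ - w + w ≡ 1ℚ + 0ℚ
      top = solve-∀ ring
      arrange : ∀ b w F → 1ℚ - w + (F - (b + w)) ≡ F + (1ℚ - w - w - b)
      arrange = solve-∀ ring

  -- Hits and their cost.

  wt≤pebbles : ∀ i c → Valid (suc i) c → wt i c ≤ pebbles (suc i) c
  wt≤pebbles zero    c        v        = pebbles-nonneg 1 c v
  wt≤pebbles (suc i) (x , cs) (vv , v) =
    +-monoʳ-≤ (pval x) (≤-trans (∑-mono (λ k → wt≤pebbles i (lookup cs k) (child v k)))
                                (≤-reflexive (sym (total-∑ (suc i) cs))))

  -- The cost of a hit, i.e. of pebbling a parent of leaves: wt does not count
  -- the leaves, d of which are full at that moment.
  Costly : ∀ i → Config d (suc i) → Set
  Costly i c = wt i c + d · 1ℚ ≤ pebbles (suc i) c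

  hit-base : ∀ x cs → VAll.All (Valid 1) cs → VAll.All (RootFull 1) cs → Costly 1 (x , cs)
  hit-base x cs v fl =
    lin (full-≤-total cs v fl) (trans (cong (λ z → pval x + z + d · 1ℚ + total 1 cs) (∑-zero {d} (λ _ → refl)))
                    (arrange (pval x) (d · 1ℚ) (total 1 cs)))
    where
    arrange : ∀ a b c → a + 0ℚ + b + c ≡ a + c + b
    arrange = solve-∀ ring

  hit-inside : ∀ i x cs → VAll.All (Valid (suc i)) cs → ∀ k → Costly i (lookup cs k) → Costly (suc i) (x , cs)
  hit-inside i x cs v k hit =
    lin (∑-except {f = λ k → pebbles (suc i) (lookup cs k)} {f' = λ k → wt i (lookup cs k)} {e = - (d · 1ℚ)} k
                  (lin hit (move (wt i (lookup cs k)) (pebbles (suc i) (lookup cs k)) (d · 1ℚ)))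
                  (λ k' _ → wt≤pebbles i (lookup cs k') (child v k')))
        (trans (arrange (pval x) (∑ (λ k → wt i (lookup cs k))) (d · 1ℚ) (∑ (λ k → pebbles (suc i) (lookup cs k))))
               (cong (λ z → pval x + z + ∑ (λ k → wt i (lookup cs k))) (sym (total-∑ (suc i) cs))))
    where
    move : ∀ a b c → a + b ≡ b + - c + (a + c)
    move = solve-∀ ring
    arrange : ∀ x W e P → x + W + e + (P + - e) ≡ x + P + W
    arrange = solve-∀ ring

  -- The effect of one move on the profile.

  Step : (ℕ → ℚ) → ∀ i → Config d (suc i) → Config d (suc i) → Set
  Step e i c c' =
    (∀ S → Σ (Free i) λ S' → ∀ j → profF S' c' j ≤ profF S c j + e j) ×
    (∀ S → Σ (Blk i) λ S' → ∀ j → profB S' c' j ≤ profB S c j + e j)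

  -- `spike` is the profile of one unit of weight on level 1, the most that a hit can add.
  spike none : ℕ → ℚ
  spike j = ind j 1 1ℚ
  none _ = 0ℚ

  private
    pad : ∀ {x y} → x ≤ y → x ≤ y + 0ℚ
    pad {y = y} x≤y = ≤-trans x≤y (≤-reflexive (sym (+-identityʳ y)))

  step-inside : ∀ e i v cs k {c'} → Step e i (lookup cs k) c' → Step e (suc i) (v , cs) (v , cs [ k ]≔ c')
  step-inside e i (b , w) cs k {c'} (stF , stB) = forF , forB
    where
    cs' = cs [ k ]≔ c'
    childF : (f : Fin d → Free i) → ∀ k' → Σ (Free i) λ S' →
             (k' ≡ k → ∀ j → profF S' (lookup cs' k') j ≤ profF (f k') (lookup cs k') j + e j) ×
             (¬ k' ≡ k → ∀ j → profF S' (lookup cs' k') j ≤ profF (f k') (lookup cs k') j)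
    childF f k' with k' ≟ᶠ k
    ... | yes refl rewrite lookup∘update k cs c' = let S' , le = stF (f k) in S' , (λ _ → le) , λ k≢k → ⊥-elim (k≢k refl)
    ... | no k'≢k rewrite lookup∘update′ k'≢k cs c' = f k' , (λ eq → ⊥-elim (k'≢k eq)) , λ _ j → ≤-refl
    childB : (s : Fin d → Blk i) → ∀ k' → Σ (Blk i) λ S' →
             (k' ≡ k → ∀ j → profB S' (lookup cs' k') j ≤ profB (s k') (lookup cs k') j + e j) ×
             (¬ k' ≡ k → ∀ j → profB S' (lookup cs' k') j ≤ profB (s k') (lookup cs k') j)
    childB s k' with k' ≟ᶠ k
    ... | yes refl rewrite lookup∘update k cs c' = let S' , le = stB (s k) in S' , (λ _ → le) , λ k≢k → ⊥-elim (k≢k refl)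
    ... | no k'≢k rewrite lookup∘update′ k'≢k cs c' = s k' , (λ eq → ⊥-elim (k'≢k eq)) , λ _ j → ≤-refl
    sumF : ∀ f j → ∑ (λ k' → profF (proj₁ (childF f k')) (lookup cs' k') j)
                     ≤ ∑ (λ k' → profF (f k') (lookup cs k') j) + e j
    sumF f j = ∑-except k (proj₁ (proj₂ (childF f k)) refl j) (λ k' ne → proj₂ (proj₂ (childF f k')) ne j)
    sumB : ∀ s j → ∑ (λ k' → profB (proj₁ (childB s k')) (lookup cs' k') j)
                     ≤ ∑ (λ k' → profB (s k') (lookup cs k') j) + e j
    sumB s j = ∑-except k (proj₁ (proj₂ (childB s k)) refl j) (λ k' ne → proj₂ (proj₂ (childB s k')) ne j)
    forF : ∀ S → Σ (Free (suc i)) λ S' → ∀ j → profF S' ((b , w) , cs') j ≤ profF S ((b , w) , cs) j + e j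
    forF (paid f) = paid (λ k' → proj₁ (childF f k')) , λ j →
      ≤-trans (+-monoʳ-≤ (ind j (suc i) b) (sumF f j)) (≤-reflexive (sym (+-assoc (ind j (suc i) b) _ (e j))))
    forF (cov s) = cov (λ k' → proj₁ (childB s k')) , sumB s
    forB : ∀ S → Σ (Blk (suc i)) λ S' → ∀ j → profB S' ((b , w) , cs') j ≤ profB S ((b , w) , cs) j + e j
    forB (full f) = full (λ k' → proj₁ (childF f k')) , λ j →
      ≤-trans (+-monoʳ-≤ (ind j (suc i) (1ℚ - w)) (sumF f j)) (≤-reflexive (sym (+-assoc (ind j (suc i) (1ℚ - w)) _ (e j))))
    forB (inner s) = inner (λ k' → proj₁ (childB s k')) , sumB s

  block : ∀ {i} → Free (suc i) → Blk (suc i)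
  block (paid f) = full f
  block (cov s)  = inner s

  -- A node of pebble value 1 has `b = 1 - w`. Its charge is thus kept, and expressed by the white
  -- value it survives the removal of the black one.
  block-≤ : ∀ {i} (S : Free (suc i)) c c' → RootFull (suc (suc i)) c → RootBlackDec (suc (suc i)) c c' →
            ∀ j → profB (block S) c' j ≤ profF S c j
  block-≤ {i} (paid f) ((b , w) , cs) (_ , _) fl (_ , refl , refl) j =
    ≤-reflexive (cong (λ x → ind j (suc i) x + ∑ (λ k → profF (f k) (lookup cs k) j))
                      (trans (cong (_- w) (sym fl)) (cancel b w)))
    where
    cancel : ∀ b w → b + w - w ≡ b
    cancel = solve-∀ ring
  block-≤ (cov s) ((b , w) , cs) (_ , _) fl (_ , refl , refl) j = ≤-refl

  dec-≤ : ∀ {i} (S : Blk (suc i)) c c' → RootBlackDec (suc (suc i)) c c' → ∀ j → profB S c' j ≤ profB S c j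
  dec-≤ (full f)  (_ , _) (_ , _) (_ , refl , refl) j = ≤-refl
  dec-≤ (inner s) (_ , _) (_ , _) (_ , refl , refl) j = ≤-refl

  -- Pebbling a node above level 1 finds its children full, so they become blocked and the node
  -- turns from paid to covered, or from full to inner, at no cost. On level 1 there is no frontier
  -- below to charge, and the node's own weight may jump by 1.
  move-step : ∀ i {c c'} → Valid (suc i) c → Valid (suc i) c' → Move (suc i) c c' →
              Step none i c c' ⊎ (Step spike i c c' × Costly i c)
  move-step zero v v' m = inj₁ ((λ { leaf → leaf , λ _ → ≤-refl }) , λ ())
  move-step (suc i) v v' (decBlack {b = b} {w} {b'} {cs} b'≤b) = inj₁ (forF , forB)
    where
    forF : ∀ S → Σ (Free (suc i)) λ S' → ∀ j → profF S' ((b' , w) , cs) j ≤ profF S ((b , w) , cs) j + 0ℚ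
    forF (paid f) = paid f , λ j → pad (+-monoˡ-≤ _ (ind-mono j (suc i) b'≤b))
    forF (cov s)  = cov s , λ j → pad ≤-refl
    forB : ∀ S → Σ (Blk (suc i)) λ S' → ∀ j → profB S' ((b' , w) , cs) j ≤ profB S ((b , w) , cs) j + 0ℚ
    forB (full f)  = full f , λ j → pad ≤-refl
    forB (inner s) = inner s , λ j → pad ≤-refl
  move-step (suc i) v v' (incWhite {b = b} {w} {w'} {cs} w≤w') = inj₁ (forF , forB)
    where
    forF : ∀ S → Σ (Free (suc i)) λ S' → ∀ j → profF S' ((b , w') , cs) j ≤ profF S ((b , w) , cs) j + 0ℚ
    forF (paid f) = paid f , λ j → pad ≤-refl
    forF (cov s)  = cov s , λ j → pad ≤-refl
    forB : ∀ S → Σ (Blk (suc i)) λ S' → ∀ j → profB S' ((b , w') , cs) j ≤ profB S ((b , w) , cs) j + 0ℚ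
    forB (full f)  = full f , λ j →
      pad (+-monoˡ-≤ _ (ind-mono j (suc i) (+-monoʳ-≤ 1ℚ (neg-antimono-≤ w≤w'))))
    forB (inner s) = inner s , λ j → pad ≤-refl
  move-step (suc zero) ((0≤b , 0≤w , b+w≤1) , v) ((_ , _ , b'≤1) , v') (place {b = b} {w} {b'} {cs} {cs'} fl b≤b' dec) =
    inj₂ ((forF , forB) , hit-base (b , w) cs v fl)
    where
    leaves : ∀ (f f' : Fin d → Free 0) ds ds' j →
             ∑ (λ k → profF (f k) (lookup {A = Config d 1} ds k) j) ≡ ∑ (λ k → profF (f' k) (lookup {A = Config d 1} ds' k) j)
    leaves f f' ds ds' j = trans (∑-zero (λ k → zero′ (f k) (lookup ds k))) (sym (∑-zero (λ k → zero′ (f' k) (lookup ds' k))))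
      where
      zero′ : ∀ S c → profF {0} S c j ≡ 0ℚ
      zero′ leaf c = refl
    jump : ∀ f f' j {x y} → x ≤ y + 1ℚ →
           ind j 1 x + ∑ (λ k → profF (f k) (lookup cs' k) j) ≤ ind j 1 y + ∑ (λ k → profF (f' k) (lookup cs k) j) + spike j
    jump f f' j {x} {y} le =
      lin (+-mono-≤ (ind-mono j 1 le) (≤-reflexive (leaves f f' cs' cs j)))
          (trans (cong (λ z → ind j 1 x + P + (z + Q)) (ind-+ j 1 y 1ℚ))
                 (arrange (ind j 1 x) P (ind j 1 y) (spike j) Q))
      where
      P = ∑ (λ k → profF (f k) (lookup cs' k) j)
      Q = ∑ (λ k → profF (f' k) (lookup cs k) j)
      arrange : ∀ x P y s Q → x + P + (y + s + Q) ≡ y + Q + s + (x + P)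
      arrange = solve-∀ ring
    forF : ∀ S → Σ (Free 1) λ S' → ∀ j → profF S' ((b' , 0ℚ) , cs') j ≤ profF S ((b , w) , cs) j + spike j
    forF (paid f) = paid f , λ j → jump f f j (lin (+-mono-≤ 0≤b b'≤1) (arrange b b'))
      where
      arrange : ∀ b b' → b' + (b + 1ℚ) ≡ b + 1ℚ + (0ℚ + (b' + 0ℚ))
      arrange = solve-∀ ring
    -- `Blk 0` is empty: leaves cannot be blocked.
    forF (cov s) with () ← s zero
    forB : ∀ S → Σ (Blk 1) λ S' → ∀ j → profB S' ((b' , 0ℚ) , cs') j ≤ profB S ((b , w) , cs) j + spike j
    forB (full f) = full f , λ j → jump f f j (lin (+-mono-≤ 0≤b b+w≤1) (arrange b w))
      where
      arrange : ∀ b w → 1ℚ - 0ℚ + (b + 1ℚ) ≡ 1ℚ - w + 1ℚ + (0ℚ + (b + w))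
      arrange = solve-∀ ring
    forB (inner s) with () ← s zero
  move-step (suc (suc i)) ((0≤b , 0≤w , b+w≤1) , v) v' (place {b = b} {w} {b'} {cs} {cs'} fl b≤b' dec) = inj₁ (forF , forB)
    where
    blocks : ∀ f j → ∑ (λ k → profB (block (f k)) (lookup cs' k) j) ≤ ∑ (λ k → profF (f k) (lookup cs k) j)
    blocks f j = ∑-mono (λ k → block-≤ (f k) (lookup cs k) (lookup cs' k) (child fl k) (dec k) j)
    decs : ∀ s j → ∑ (λ k → profB (s k) (lookup cs' k) j) ≤ ∑ (λ k → profB (s k) (lookup cs k) j)
    decs s j = ∑-mono (λ k → dec-≤ (s k) (lookup cs k) (lookup cs' k) (dec k) j)
    drop : ∀ {x y z} → 0ℚ ≤ z → x ≤ y → x ≤ z + y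
    drop {x} {y} {z} 0≤z x≤y = lin (+-mono-≤ 0≤z x≤y) (arrange x y z)
      where
      arrange : ∀ x y z → x + (z + y) ≡ z + y + (0ℚ + x)
      arrange = solve-∀ ring
    forF : ∀ S → Σ (Free (suc (suc i))) λ S' → ∀ j → profF S' ((b' , 0ℚ) , cs') j ≤ profF S ((b , w) , cs) j + 0ℚ
    forF (paid f) = cov (λ k → block (f k)) , λ j → pad (drop (ind-nonneg j _ 0≤b) (blocks f j))
    forF (cov s)  = cov s , λ j → pad (decs s j)
    forB : ∀ S → Σ (Blk (suc (suc i))) λ S' → ∀ j → profB S' ((b' , 0ℚ) , cs') j ≤ profB S ((b , w) , cs) j + 0ℚ
    forB (full f)  = inner (λ k → block (f k)) , λ j →
      pad (drop (ind-nonneg j _ (w≤1 (0≤b , 0≤w , b+w≤1))) (blocks f j))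
    forB (inner s) = inner s , λ j → pad (decs s j)
  move-step (suc i) (_ , v) (_ , v') (inside {v = x} {cs} k {c'} m)
    with move-step i (child v k) (subst (Valid (suc i)) (lookup∘update k cs c') (child v' k)) m
  ... | inj₁ st         = inj₁ (step-inside none i x cs k st)
  ... | inj₂ (st , hit) = inj₂ (step-inside spike i x cs k st , hit-inside i x cs v k hit)

  -- The invariant along a pebbling.

  BoundedAt : ℚ → ℕ → ℚ → Set
  BoundedAt M j x = x + x ≤ 0ℚ ⊎ j · K + (x + x) ≤ M

  -- Levels without weight are exempt, as at the start and above the root, where `j · K` may exceed
  -- `M`.
  Bounded : ℚ → (ℕ → ℚ) → Set
  Bounded M f = ∀ j → BoundedAt M j (f j)

  boundedAt-≤ : ∀ {M} j {x x'} → x' ≤ x → BoundedAt M j x → BoundedAt M j x'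
  boundedAt-≤ j le (inj₁ x≤0) = inj₁ (≤-trans (+-mono-≤ le le) x≤0)
  boundedAt-≤ j le (inj₂ x≤M) = inj₂ (≤-trans (+-monoʳ-≤ (j · K) (+-mono-≤ le le)) x≤M)

  bounded-⊑ : ∀ {M f' f} → f' ⊑ f → Bounded M f → Bounded M f'
  bounded-⊑ {M} {f'} {f} f'⊑f bd j with _⊑_.level f'⊑f j
  ... | l , l≤j , le with bd l
  ... | inj₁ f≤0 = inj₁ (lin (+-mono-≤ le (+-mono-≤ f≤0 (·-mono-ℕ 0≤K l≤j)))
                             (arrange (f' j) (f l) (j · K) (l · K)))
    where
    arrange : ∀ x y a b → x + x + (b + (y + y) + (0ℚ + a)) ≡ 0ℚ + (a + (x + x) + (y + y + b))
    arrange = solve-∀ ring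
  ... | inj₂ f≤M = inj₂ (≤-trans le f≤M)

  module Bound (p : ℚ) where

    -- A normalised labelling weighs at most wt + 1, at a hit wt ≤ p - d, and
    -- the hit adds at most 1 on level 1: hence the bound K + 2 (p - d + 2).
    M : ℚ
    M = p + p + 1ℚ + 1ℚ - K

    -- On levels 0 and 1 the bound is obtained afresh from the number of pebbles; on higher levels
    -- the hit adds nothing.
    bounded-hit : ∀ {f f' W} → Antitone f → (∀ j → f' j ≤ f j + spike j) → f 0 ≤ W + 1ℚ → W + d · 1ℚ ≤ p →
                  Bounded M f → Bounded M f'
    bounded-hit {f} {f'} {W} anti le f0≤ W≤ bd j = go j (le j)
      where
      low-level : ∀ j → f' j ≤ f j + 1ℚ → j · K ≤ K → j · K + (f' j + f' j) ≤ M
      low-level j le jK≤K =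
        lin (+-mono-≤ jK≤K (+-mono-≤ (twice le) (+-mono-≤ (twice (anti {0} {j} z≤n)) (+-mono-≤ (twice f0≤) (twice W≤)))))
            (arrange p (j · K) K (f' j) (f j) (f 0) W)
        where
        twice : ∀ {x y} → x ≤ y → x + x ≤ y + y
        twice x≤y = +-mono-≤ x≤y x≤y
        arrange : ∀ p jK K f' f f0 W →
          jK + (f' + f') + (K + (f + 1ℚ + (f + 1ℚ) + (f0 + f0 + (W + 1ℚ + (W + 1ℚ) + (p + p)))))
            ≡ p + p + 1ℚ + 1ℚ - K
              + (jK + (f' + f' + (f + f + (f0 + f0 + (W + (1ℚ + K) + (W + (1ℚ + K)))))))
        arrange = solve-∀ ring
      go : ∀ j → f' j ≤ f j + spike j → BoundedAt M j (f' j)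
      go zero          le = inj₂ (low-level 0 le 0≤K)
      go (suc zero)    le = inj₂ (low-level 1 le (≤-reflexive (+-identityʳ K)))
      go (suc (suc j)) le = boundedAt-≤ (suc (suc j)) {f (suc (suc j))} (≤-trans le (≤-reflexive (+-identityʳ _))) (bd (suc (suc j)))

    advanceF : ∀ {i c c'} → Path (suc i) p c c' → Σ (Free i) (λ S → Bounded M (profF S c)) →
               Σ (Free i) (λ S → Bounded M (profF S c'))
    advanceF (stop _) inv = inv
    advanceF {i} {c} (step (v , b) m rest) (S , bd) with move-step i v (proj₁ (start rest)) m
    ... | inj₁ (st , _) = let S' , le = st S in
      advanceF rest (S' , λ j → boundedAt-≤ j {profF S c j} (≤-trans (le j) (≤-reflexive (+-identityʳ _))) (bd j))
    -- Normalising just before the hit is what allows the profile to be compared with `wt`.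
    ... | inj₂ ((st , _) , hit) =
      let S₁ , nrm , S₁⊑S = normaliseF S c v
          S' , le = st S₁
      in advanceF rest (S' , bounded-hit {f = profF S₁ c} {W = wt i c} (profF-anti S₁ c v) le
                               (≤-trans (sizeF S₁ c v nrm) (lin 0≤1 (arrange (wt i c))))
                               (≤-trans hit b) (bounded-⊑ S₁⊑S bd))
      where
      arrange : ∀ x → x + 1ℚ ≡ x + 1ℚ + 0ℚ
      arrange = solve-∀ ring

    advanceB : ∀ {i c c'} → Path (suc (suc i)) p c c' → Σ (Blk (suc i)) (λ S → Bounded M (profB S c)) →
               Σ (Blk (suc i)) (λ S → Bounded M (profB S c'))
    advanceB (stop _) inv = inv
    advanceB {i} {c@((b , w) , cs)} (step (v@((0≤b , 0≤w , _) , _) , bound) m rest) (S , bd)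
      with move-step (suc i) v (proj₁ (start rest)) m
    ... | inj₁ (_ , st) = let S' , le = st S in
      advanceB rest (S' , λ j → boundedAt-≤ j {profB S c j} (≤-trans (le j) (≤-reflexive (+-identityʳ _))) (bd j))
    ... | inj₂ ((_ , st) , hit) =
      let S₁ , nrm , S₁⊑S = normaliseB S c v
          S' , le = st S₁
      in advanceB rest (S' , bounded-hit {f = profB S₁ c} {W = wt (suc i) c} (profB-anti S₁ c v) le
                               (≤-trans (sizeB S₁ c v nrm)
                                        -- The excess of a normal blocked labelling is at most
                                        -- `1 - w - w - b ≤ 1`, whence the `+ 1` in `bounded-hit`.
                                        (lin (+-mono-≤ (F≤ S₁ b w cs nrm) (+-mono-≤ 0≤b (+-mono-≤ 0≤w 0≤w)))
                                             (arrange b w (wt (suc i) c) (F S₁ c))))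
                               (≤-trans hit bound) (bounded-⊑ S₁⊑S bd))
      where
      arrange : ∀ b w W F → W + F + (1ℚ - w - w - b + (b + (w + w))) ≡ W + 1ℚ + (F + (0ℚ + (0ℚ + 0ℚ)))
      arrange = solve-∀ ring

  -- Conclusion of the general lower bound.

  allPaid : ∀ i → Free i
  allPaid zero    = leaf
  allPaid (suc i) = paid (λ _ → allPaid i)

  allPaid-empty : ∀ i j → profF (allPaid i) (empty d (suc i)) j ≤ 0ℚ
  allPaid-empty zero    j = ≤-refl
  allPaid-empty (suc i) j =
    +-mono-≤ (≤-reflexive (ind-0 j (suc i)))
      (∑-nonpos {f = λ k → profF (allPaid i) (lookup (replicate d (empty d (suc i))) k) j}
        λ k → subst (λ c → profF (allPaid i) c j ≤ 0ℚ) (sym (lookup-replicate k (empty d (suc i))))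
                            (allPaid-empty i j))

  -- Without white pebbles each frontier node has extra weight 1.
  N≤prof-empty : ∀ {i} (S : Blk i) {l} → l ℕ.≤ low S → N S ≤ profB S (empty d (suc i)) l
  N≤prof-empty (full {i} f) {l} l≤ rewrite ind-in (1ℚ - 0ℚ) l≤ =
    lin (∑-nonneg {f = λ k → profF (f k) (lookup (replicate d (empty d (suc i))) k) l}
          λ k → subst (λ c → 0ℚ ≤ profF (f k) c l) (sym (lookup-replicate k (empty d (suc i))))
                      (profF-nonneg (f k) (empty d (suc i)) (valid-empty d (suc i)) l))
        (arrange (∑ λ k → profF (f k) (lookup (replicate d (empty d (suc i))) k) l))
    where
    arrange : ∀ P → 1ℚ + P ≡ 1ℚ - 0ℚ + P + 0ℚ
    arrange = solve-∀ ring
  N≤prof-empty (inner {i} s) {l} l≤ =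
    ∑-mono λ k → subst (λ c → N (s k) ≤ profB (s k) c l) (sym (lookup-replicate k (empty d (suc i))))
                       (N≤prof-empty (s k) (ℕ.≤-trans l≤ (min-≤ (λ k → low (s k)) k)))

  root-full : ∀ {b w} → ValidVal (b , w) → b ≡ 1ℚ → b + w ≡ 1ℚ
  root-full {b} {w} (_ , 0≤w , b+w≤1) refl = ≤-antisym b+w≤1 (+-monoʳ-≤ 1ℚ 0≤w)

  -- The labelling is free until the root has black value 1; then `block` makes it blocked without
  -- enlarging its profile, and it stays blocked until the tree is empty.
  lower : ∀ h p → FracPebbling d (suc (suc h)) p → suc (suc h) · K ≤ p + p
  lower h p fp with toPaths fp
  ... | c@((b , w) , cs) , black , path , path' = conclude (bd (low T))
    where
    open Bound p
    phase₁ : Σ (Free (suc h)) λ S → Bounded M (profF S c)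
    phase₁ = advanceF path
      (allPaid (suc h) , λ j → inj₁ (+-mono-≤ (allPaid-empty (suc h) j) (allPaid-empty (suc h) j)))
    phase₂ : Σ (Blk (suc h)) λ S → Bounded M (profB S (empty d (suc (suc h))))
    phase₂ = advanceB path'
      (block (proj₁ phase₁) , λ j →
        boundedAt-≤ j {profF (proj₁ phase₁) c j} (block-≤ (proj₁ phase₁) c c (root-full (proj₁ (proj₁ (end path))) black)
                               (≤-refl , refl , refl) j)
                      (proj₂ phase₁ j))
    T = proj₁ phase₂
    bd = proj₂ phase₂
    P = profB T (empty d (suc (suc h))) (low T)
    N≤P : N T ≤ P
    N≤P = N≤prof-empty T ℕ.≤-refl
    conclude : BoundedAt M (low T) P → suc (suc h) · K ≤ p + p
    conclude (inj₁ P≤0) = ⊥-elim (1≰0 (lin (+-mono-≤ P≤0 (+-mono-≤ 1≤P 1≤P)) (arrange P)))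
      where
      1≰0 : ¬ 1ℚ + 1ℚ ≤ 0ℚ
      1≰0 le with () ← ≤⇒≤ᵇ le
      1≤P = ≤-trans (1≤N T) N≤P
      arrange : ∀ P → 1ℚ + 1ℚ + (0ℚ + (P + P)) ≡ 0ℚ + (P + P + (1ℚ + 1ℚ))
      arrange = solve-∀ ring
    -- With `x = low T`, `N-low` and the bound on level `x` give `2p ≥ (2(h+1) - x + 1) K`, and
    -- `x ≤ h+1`.
    conclude (inj₂ P≤M) =
      lin (+-mono-≤ P≤M (+-mono-≤ N≤P (+-mono-≤ N≤P (+-mono-≤ (N-low T) (+-mono-≤ (N-low T) (·-mono-ℕ 0≤K (low≤ T)))))))
          (arrange p K P (N T) (low T · K) (suc h · K))
      where
      arrange : ∀ p K P N lK iK →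
        K + iK + (p + p + 1ℚ + 1ℚ - K + (P + (P + (N + lK + (N + lK + iK)))))
          ≡ p + p + (lK + (P + P) + (N + (N + (1ℚ + iK + (1ℚ + iK + lK)))))
      arrange = solve-∀ ring

-- Heights 3 and 4

module Interval (n : ℕ) where
  open Potential n

  -- Cov i c c': on every path from the root of a subtree to its leaves there is
  -- a node whose black value in c and white value in c' add up to at least 1.
  Cov : ∀ i → Config d (suc i) → Config d (suc i) → Set
  Cov zero    _              _                = ⊥
  Cov (suc i) ((b , _) , cs) ((_ , w') , cs') = 1ℚ ≤ b + w' ⊎ (∀ k → Cov i (lookup cs k) (lookup cs' k))

  -- The transitive closure of the moves other than hits is contained in Quiet.
  Quiet : ∀ i → Config d (suc i) → Config d (suc i) → Set
  Quiet zero    _              _                 = ⊤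
  Quiet (suc i) ((b , w) , cs) ((b' , w') , cs') =
    (∀ k → Quiet i (lookup cs k) (lookup cs' k)) ×
    ((b' ≤ b × w ≤ w') ⊎ (∀ k → Cov i (lookup cs k) (lookup cs' k)))

  quiet-refl : ∀ i c → Quiet i c c
  quiet-refl zero    c        = tt
  quiet-refl (suc i) (v , cs) = (λ k → quiet-refl i (lookup cs k)) , inj₁ (≤-refl , ≤-refl)

  -- If the covering node is pebbled during the other interval, its children are covered over that
  -- interval; the argument continues one level down with the intervals exchanged.
  cov-quiet : ∀ i c₁ c₂ c₃ → Quiet i c₁ c₂ → Cov i c₁ c₂ → Quiet i c₂ c₃ → Cov i c₁ c₃
  quiet-cov : ∀ i c₁ c₂ c₃ → Quiet i c₁ c₂ → Cov i c₂ c₃ → Quiet i c₂ c₃ → Cov i c₁ c₃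
  cov-quiet (suc i) ((b₁ , _) , cs₁) (_ , cs₂) (_ , cs₃) (q , _) (inj₁ le) (q' , inj₁ (_ , w≤)) =
    inj₁ (≤-trans le (+-monoʳ-≤ b₁ w≤))
  cov-quiet (suc i) (_ , cs₁) (_ , cs₂) (_ , cs₃) (q , _) (inj₁ le) (q' , inj₂ cv) =
    inj₂ λ k → quiet-cov i (lookup cs₁ k) (lookup cs₂ k) (lookup cs₃ k) (q k) (cv k) (q' k)
  cov-quiet (suc i) (_ , cs₁) (_ , cs₂) (_ , cs₃) (q , _) (inj₂ cv) (q' , _) =
    inj₂ λ k → cov-quiet i (lookup cs₁ k) (lookup cs₂ k) (lookup cs₃ k) (q k) (cv k) (q' k)
  quiet-cov (suc i) (_ , cs₁) (_ , cs₂) ((_ , w₃) , cs₃) (q , inj₁ (b≤ , _)) (inj₁ le) (q' , _) =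
    inj₁ (≤-trans le (+-monoˡ-≤ w₃ b≤))
  quiet-cov (suc i) (_ , cs₁) (_ , cs₂) (_ , cs₃) (q , inj₂ cv) (inj₁ le) (q' , _) =
    inj₂ λ k → cov-quiet i (lookup cs₁ k) (lookup cs₂ k) (lookup cs₃ k) (q k) (cv k) (q' k)
  quiet-cov (suc i) (_ , cs₁) (_ , cs₂) (_ , cs₃) (q , _) (inj₂ cv) (q' , _) =
    inj₂ λ k → quiet-cov i (lookup cs₁ k) (lookup cs₂ k) (lookup cs₃ k) (q k) (cv k) (q' k)

  quiet-trans : ∀ i c₁ c₂ c₃ → Quiet i c₁ c₂ → Quiet i c₂ c₃ → Quiet i c₁ c₃
  quiet-trans zero    _ _ _ _ _ = tt
  quiet-trans (suc i) ((b₁ , w₁) , cs₁) (_ , cs₂) ((b₃ , w₃) , cs₃) (q , own) (q' , own') =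
    (λ k → quiet-trans i (lookup cs₁ k) (lookup cs₂ k) (lookup cs₃ k) (q k) (q' k)) , both own own'
    where
    both : _ → _ → (b₃ ≤ b₁ × w₁ ≤ w₃) ⊎ (∀ k → Cov i (lookup cs₁ k) (lookup cs₃ k))
    both (inj₁ (b≤ , w≤)) (inj₁ (b≤' , w≤')) = inj₁ (≤-trans b≤' b≤ , ≤-trans w≤ w≤')
    both (inj₁ _)         (inj₂ cv) =
      inj₂ λ k → quiet-cov i (lookup cs₁ k) (lookup cs₂ k) (lookup cs₃ k) (q k) (cv k) (q' k)
    both (inj₂ cv)        _ =
      inj₂ λ k → cov-quiet i (lookup cs₁ k) (lookup cs₂ k) (lookup cs₃ k) (q k) (cv k) (q' k)

  -- Records what a hit leaves unchanged: everything outside the subtree of the pebbled parent of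
  -- leaves.
  HitAt : ∀ i → Config d (suc i) → Config d (suc i) → Set
  HitAt zero          _        _          = ⊥
  HitAt (suc zero)    _        _          = ⊤
  HitAt (suc (suc i)) (v , cs) (v' , cs') =
    v' ≡ v × Σ (Fin d) λ k → HitAt (suc i) (lookup cs k) (lookup cs' k) ×
                             (∀ k' → ¬ k' ≡ k → lookup cs' k' ≡ lookup cs k')

  placed-cov : ∀ i c c' → RootFull (suc (suc i)) c → RootBlackDec (suc (suc i)) c c' → Cov (suc i) c c'
  placed-cov i ((b , w) , cs) (_ , _) fl (_ , refl , refl) = inj₁ (≤-reflexive (sym fl))

  placed-quiet : ∀ i c c' → RootBlackDec (suc (suc i)) c c' → Quiet (suc i) c c'
  placed-quiet i ((b , w) , cs) (_ , _) (le , refl , refl) = (λ k → quiet-refl i (lookup cs k)) , inj₁ (le , ≤-refl)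

  classify : ∀ i {c c'} → Valid (suc i) c → Move (suc i) c c' → Quiet i c c' ⊎ (HitAt i c c' × Costly i c)
  classify zero    v m = inj₁ tt
  classify (suc i) v (decBlack {cs = cs} b≤) = inj₁ ((λ k → quiet-refl i (lookup cs k)) , inj₁ (b≤ , ≤-refl))
  classify (suc i) v (incWhite {cs = cs} w≤) = inj₁ ((λ k → quiet-refl i (lookup cs k)) , inj₁ (≤-refl , w≤))
  classify (suc zero) (_ , v) (place {b = b} {w} {cs = cs} fl _ dec) = inj₂ (tt , hit-base (b , w) cs v fl)
  classify (suc (suc i)) v (place {cs = cs} {cs'} fl _ dec) =
    inj₁ ((λ k → placed-quiet i (lookup cs k) (lookup cs' k) (dec k)) ,
          inj₂ λ k → placed-cov i (lookup cs k) (lookup cs' k) (child fl k) (dec k))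
  classify (suc i) (_ , v) (inside {v = x} {cs} k {c'} m) with classify i (child v k) m
  ... | inj₁ q = inj₁ (ch , inj₁ (≤-refl , ≤-refl))
    where
    ch : ∀ k' → Quiet i (lookup cs k') (lookup (cs [ k ]≔ c') k')
    ch k' with k' ≟ᶠ k
    ... | yes refl rewrite lookup∘update k cs c' = q
    ... | no k'≢k rewrite lookup∘update′ k'≢k cs c' = quiet-refl i (lookup cs k')
  classify (suc (suc i)) (_ , v) (inside {v = x} {cs} k {c'} m) | inj₂ (at , hit) =
    inj₂ ((refl , k , subst (HitAt (suc i) (lookup cs k)) (sym (lookup∘update k cs c')) at ,
           λ k' k'≢k → lookup∘update′ k'≢k cs c') , hit-inside (suc i) x cs v k hit)

  wt-nonneg : ∀ i c → Valid (suc i) c → 0ℚ ≤ wt i c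
  wt-nonneg zero    c        v = ≤-refl
  wt-nonneg (suc i) (x , cs) ((0≤b , 0≤w , _) , v) =
    +-mono-≤ (+-mono-≤ 0≤b 0≤w) (∑-nonneg (λ k → wt-nonneg i (lookup cs k) (child v k)))

  black≤wt : ∀ i b w cs → Valid (suc (suc i)) ((b , w) , cs) → b ≤ wt (suc i) ((b , w) , cs)
  black≤wt i b w cs ((_ , 0≤w , _) , v) =
    lin (+-mono-≤ 0≤w (∑-nonneg (λ k → wt-nonneg i (lookup cs k) (child v k)))) (arrange b w _)
    where
    arrange : ∀ b w W → b + (w + W) ≡ b + w + W + (0ℚ + 0ℚ)
    arrange = solve-∀ ring

  white≤wt : ∀ i b w cs → Valid (suc (suc i)) ((b , w) , cs) → w ≤ wt (suc i) ((b , w) , cs)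
  white≤wt i b w cs ((0≤b , _) , v) =
    lin (+-mono-≤ 0≤b (∑-nonneg (λ k → wt-nonneg i (lookup cs k) (child v k)))) (arrange b w _)
    where
    arrange : ∀ b w W → w + (b + W) ≡ b + w + W + (0ℚ + 0ℚ)
    arrange = solve-∀ ring

  child≤wt : ∀ i x cs → Valid (suc (suc i)) (x , cs) → ∀ k → wt i (lookup cs k) ≤ wt (suc i) (x , cs)
  child≤wt i x cs ((0≤b , 0≤w , _) , v) k =
    lin (+-mono-≤ (+-mono-≤ 0≤b 0≤w) (∑-≥ {f = λ k → wt i (lookup cs k)} k (λ k → wt-nonneg i (lookup cs k) (child v k))))
        (arrange (pval x) (wt i (lookup cs k)) (∑ (λ k → wt i (lookup cs k))))
    where
    arrange : ∀ x a b → a + (x + b) ≡ x + b + (0ℚ + 0ℚ + a)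
    arrange = solve-∀ ring

  children≤wt : ∀ i x cs → ValidVal x → ∑ (λ k → wt i (lookup cs k)) ≤ wt (suc i) (x , cs)
  children≤wt i x cs (0≤b , 0≤w , _) = lin (+-mono-≤ 0≤b 0≤w) (arrange (pval x) (∑ (λ k → wt i (lookup cs k))))
    where
    arrange : ∀ x a → a + x ≡ x + a + (0ℚ + 0ℚ)
    arrange = solve-∀ ring

  wt-empty : ∀ i → wt i (empty d (suc i)) ≡ 0ℚ
  wt-empty zero    = refl
  wt-empty (suc i) = trans (+-identityˡ _) (∑-zero {d} {λ k → wt i (lookup (replicate d (empty d (suc i))) k)} λ k →
    trans (cong (wt i) (lookup-replicate k (empty d (suc i)))) (wt-empty i))

  -- The hits around the pebbling of the root.

  module _ {p : ℚ} where

    Affordable : ∀ i → Config d (suc i) → Set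
    Affordable i c = Valid (suc i) c × wt i c + d · 1ℚ ≤ p

    -- The quiet interval starts right after a hit, at `c`, whereas the pebble bound holds for
    -- `before`. If there was no hit, the two coincide.
    record Source i (c : Config d (suc i)) : Set where
      constructor source
      field
        before : Config d (suc i)
        cheap  : Affordable i before
        valid  : Valid (suc i) c
        hit    : before ≡ c ⊎ HitAt i before c

    lastHit : ∀ {i c₁ c e} → Path (suc i) p c e → Source i c₁ → Quiet i c₁ c →
              Σ (Config d (suc i)) λ c₁' → Source i c₁' × Quiet i c₁' e
    lastHit (stop _) src q = _ , src , q
    lastHit {i} {c₁} {c} (step {b = c'} (v , b) m rest) src q with classify i v m
    ... | inj₁ q'          = lastHit rest src (quiet-trans i c₁ c c' q q')
    ... | inj₂ (at , cost) =
      lastHit rest (source c (v , ≤-trans cost b) (proj₁ (start rest)) (inj₂ at)) (quiet-refl i c')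

    firstHit : ∀ {i c e} → Path (suc i) p c e → Affordable i e →
               Σ (Config d (suc i)) λ c₂ → Affordable i c₂ × Quiet i c c₂
    firstHit {i} {c} (stop _) aff = c , aff , quiet-refl i c
    firstHit {i} {c} (step {b = c'} (v , b) m rest) aff with classify i v m
    ... | inj₁ q          = let c₂ , aff' , q' = firstHit rest aff in c₂ , aff' , quiet-trans i c c' c₂ q q'
    ... | inj₂ (_ , cost) = c , (v , ≤-trans cost b) , quiet-refl i c

    record RootPlaced i (c e : Config d (suc (suc (suc i)))) : Set where
      constructor rootPlaced
      field
        {x x'}   : Val
        {cs cs'} : Vec (Config d (suc (suc i))) d
        prefix   : Path (suc (suc (suc i))) p c (x , cs)
        covers   : ∀ k → Cov (suc i) (lookup cs k) (lookup cs' k)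
        quiet    : ∀ k → Quiet (suc i) (lookup cs k) (lookup cs' k)
        d≤p      : d · 1ℚ ≤ p
        suffix   : Path (suc (suc (suc i))) p (x' , cs') e

    -- The path is searched from its end: every move other than pebbling the root leaves its black
    -- value alone or lowers it, so the value was 1 before that move too.
    findPlace : ∀ {i c e} → Path (suc (suc (suc i))) p c e → rootBlack (suc (suc (suc i))) e ≡ 1ℚ →
                rootBlack (suc (suc (suc i))) c ≡ 1ℚ ⊎ RootPlaced i c e
    findPlace (stop _) black = inj₁ black
    findPlace {i} (step ok@(v , bound) m rest) black with findPlace rest black
    ... | inj₂ (rootPlaced pre cv q le suf) = inj₂ (rootPlaced (step ok m pre) cv q le suf)
    findPlace (step (((0≤b , 0≤w , b+w≤1) , _) , _) (decBlack {b = b} {w} b'≤b) rest) black | inj₁ eq =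
      inj₁ (≤-antisym (lin (+-mono-≤ 0≤w b+w≤1) (arrange b w)) (subst (_≤ b) eq b'≤b))
      where
      arrange : ∀ b w → b + (w + 1ℚ) ≡ 1ℚ + (0ℚ + (b + w))
      arrange = solve-∀ ring
    findPlace (step _ (incWhite _) rest) black | inj₁ eq = inj₁ eq
    findPlace (step _ (inside _ _) rest) black | inj₁ eq = inj₁ eq
    findPlace {i} (step ok@(((0≤b , 0≤w , _) , v) , bound) (place {cs = cs} {cs'} fl _ dec) rest) black | inj₁ _ =
      inj₂ (rootPlaced (stop ok) (λ k → placed-cov i (lookup cs k) (lookup cs' k) (child fl k) (dec k))
                       (λ k → placed-quiet i (lookup cs k) (lookup cs' k) (dec k)) d≤p rest)
      where
      d≤p : d · 1ℚ ≤ p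
      d≤p = ≤-trans (full-≤-total cs v fl)
              (≤-trans (lin (+-mono-≤ 0≤b 0≤w) (arrange _ (total (suc (suc i)) cs))) bound)
        where
        arrange : ∀ x t → t + x ≡ x + t + (0ℚ + 0ℚ)
        arrange = solve-∀ ring

    record Sandwich i : Set where
      constructor sandwich
      field
        {x₁ x₂}   : Val
        {cs₁ cs₂} : Vec (Config d (suc (suc i))) d
        left   : Source (suc (suc i)) (x₁ , cs₁)
        right  : Affordable (suc (suc i)) (x₂ , cs₂)
        covers : ∀ k → Cov (suc i) (lookup cs₁ k) (lookup cs₂ k)

    between-hits : ∀ i → FracPebbling d (suc (suc (suc i))) p → Sandwich i
    between-hits i fp with toPaths fp
    ... | c , black , path , path' with findPlace path black
    ... | inj₁ 0≡1 with () ← 0≡1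
    ... | inj₂ (rootPlaced {x} {x'} {cs} {cs'} pre cv q d≤p suf) =
      sandwich (proj₁ (proj₂ L)) (proj₁ (proj₂ R)) λ k →
        quiet-cov (suc i) (lookup cs₁ k) (lookup cs k) (lookup cs₂ k) (q₁ k)
          (cov-quiet (suc i) (lookup cs k) (lookup cs' k) (lookup cs₂ k) (q k) (cv k) (q₂ k))
          (quiet-trans (suc i) (lookup cs k) (lookup cs' k) (lookup cs₂ k) (q k) (q₂ k))
      where
      e = empty d (suc (suc (suc i)))
      -- If a side has no hit, the empty tree takes its place; it is affordable because the `d` full
      -- children of the root show `d ≤ p`.
      aff : Affordable (suc (suc i)) e
      aff = valid-empty d (suc (suc (suc i))) ,
            ≤-trans (≤-reflexive (trans (cong (_+ d · 1ℚ) (wt-empty (suc (suc i)))) (+-identityˡ (d · 1ℚ)))) d≤p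
      L = lastHit pre (source e aff (proj₁ aff) (inj₁ refl)) (quiet-refl (suc (suc i)) e)
      R = firstHit (suf ⊳ path') aff
      cs₁ = proj₂ (proj₁ L)
      cs₂ = proj₂ (proj₁ R)
      q₁ = proj₁ (proj₂ (proj₂ L))
      q₂ = proj₁ (proj₂ (proj₂ R))

  -- The children of the root are parents of leaves, so each must cover itself. Thus `d` is at most
  -- the black weight on them after the last hit, at most `p - d + 1`, plus the white weight before
  -- the next, at most `p - d`.
  height-3 : ∀ {p} → FracPebbling d 3 p → d · 1ℚ + (d · 1ℚ + d · 1ℚ) ≤ p + p + 1ℚ
  height-3 {p} fp with between-hits {p} 0 fp
  ... | sandwich {_} {x₂} {cs₁} {cs₂} (source (x₀ , cs₀) ((vx₀ , v₀) , cheap₀) (vx₁ , v₁) hit) ((vx₂ , v₂) , cheap₂) cv =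
    lin (+-mono-≤ cover (+-mono-≤ (blacks hit) (+-mono-≤ whites
          (+-mono-≤ (children≤wt 1 x₀ cs₀ vx₀) (+-mono-≤ cheap₀ cheap₂)))))
        (arrange p (d · 1ℚ) (∑ (λ k → blk (proj₁ (lookup cs₁ k)))) (∑ (λ k → wht (proj₁ (lookup cs₂ k))))
                 (∑ (λ k → wt 1 (lookup cs₀ k))) (wt 2 (x₀ , cs₀)) (wt 2 (x₂ , cs₂)))
    where
    own : ∀ k → 1ℚ ≤ blk (proj₁ (lookup cs₁ k)) + wht (proj₁ (lookup cs₂ k))
    own k with cv k
    ... | inj₁ le = le
    ... | inj₂ cv′ with () ← cv′ zero
    cover : d · 1ℚ ≤ ∑ (λ k → blk (proj₁ (lookup cs₁ k))) + ∑ (λ k → wht (proj₁ (lookup cs₂ k)))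
    cover = subst₂ _≤_ (∑-const d 1ℚ) (∑-+ (λ k → blk (proj₁ (lookup cs₁ k))) (λ k → wht (proj₁ (lookup cs₂ k)))) (∑-mono own)
    whites : ∑ (λ k → wht (proj₁ (lookup cs₂ k))) ≤ wt 2 (x₂ , cs₂)
    whites = ≤-trans (∑-mono (λ k → white≤wt 0 _ _ (proj₂ (lookup cs₂ k)) (child v₂ k))) (children≤wt 1 x₂ cs₂ vx₂)
    blacks : _ ⊎ _ → ∑ (λ k → blk (proj₁ (lookup cs₁ k))) ≤ ∑ (λ k → wt 1 (lookup cs₀ k)) + 1ℚ
    blacks (inj₁ refl) = ≤-trans (∑-mono (λ k → black≤wt 0 _ _ (proj₂ (lookup cs₀ k)) (child v₀ k)))
                                 (lin 0≤1 (slack (∑ (λ k → wt 1 (lookup cs₀ k)))))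
      where
      slack : ∀ x → x + 1ℚ ≡ x + 1ℚ + 0ℚ
      slack = solve-∀ ring
    blacks (inj₂ (_ , k₀ , _ , same)) = ∑-except k₀ new old
      where
      new : blk (proj₁ (lookup cs₁ k₀)) ≤ wt 1 (lookup cs₀ k₀) + 1ℚ
      new = let (_ , 0≤w , le) , _ = child v₁ k₀
            in lin (+-mono-≤ (wt-nonneg 1 (lookup cs₀ k₀) (child v₀ k₀)) (+-mono-≤ 0≤w le))
                   (slack (blk (proj₁ (lookup cs₁ k₀))) (wht (proj₁ (lookup cs₁ k₀))) (wt 1 (lookup cs₀ k₀)))
        where
        slack : ∀ b w W → b + (W + (w + 1ℚ)) ≡ W + 1ℚ + (0ℚ + (0ℚ + (b + w)))
        slack = solve-∀ ring
      old : ∀ k → ¬ k ≡ k₀ → blk (proj₁ (lookup cs₁ k)) ≤ wt 1 (lookup cs₀ k)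
      old k k≢ rewrite same k k≢ = black≤wt 0 _ _ (proj₂ (lookup cs₀ k)) (child v₀ k)
    arrange : ∀ p D B W S X Y →
      D + (D + D) + (B + W + (S + 1ℚ + (Y + (X + (p + p)))))
        ≡ p + p + 1ℚ + (D + (B + (W + (S + (X + D + (Y + D))))))
    arrange = solve-∀ ring

  -- Following first children downwards leads to a covering node, whose two values count in the
  -- weights.
  cov-weight : ∀ i c c' → Valid (suc i) c → Valid (suc i) c' → Cov i c c' → 1ℚ ≤ wt i c + wt i c'
  cov-weight (suc i) ((b , w) , cs) ((b' , w') , cs') v v' (inj₁ le) =
    ≤-trans le (+-mono-≤ (black≤wt i b w cs v) (white≤wt i b' w' cs' v'))
  cov-weight (suc i) (x , cs) (x' , cs') v v' (inj₂ cv) =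
    ≤-trans (cov-weight i (lookup cs zero) (lookup cs' zero) (child (proj₂ v) zero) (child (proj₂ v') zero) (cv zero))
            (+-mono-≤ (child≤wt i x cs v zero) (child≤wt i x' cs' v' zero))

-- Height 4 in the binary tree.

module Height4 where
  open Potential 1
  open Interval 1

  another : ∀ (k : Fin 2) → Σ (Fin 2) λ k' → ¬ k' ≡ k
  another zero       = suc zero , λ ()
  another (suc zero) = zero , λ ()

  -- The hit spares the root and one of its two children, and one of these supplies the weight. This
  -- avoids the extra 1 allowed at height 3.
  cov-hit : ∀ c₀ c₁ c₂ → Valid 3 c₀ → Valid 3 c₂ → HitAt 2 c₀ c₁ → Cov 2 c₁ c₂ → 1ℚ ≤ wt 2 c₀ + wt 2 c₂
  cov-hit ((b , w) , cs₀) (_ , cs₁) ((b' , w') , cs₂) v₀ v₂ (refl , _) (inj₁ le) =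
    ≤-trans le (+-mono-≤ (black≤wt 1 b w cs₀ v₀) (white≤wt 1 b' w' cs₂ v₂))
  cov-hit (x₀ , cs₀) (_ , cs₁) (x₂ , cs₂) v₀ v₂ (_ , k₀ , _ , same) (inj₂ cv) with another k₀
  ... | k , k≢k₀ =
    ≤-trans (cov-weight 1 (lookup cs₀ k) (lookup cs₂ k) (child (proj₂ v₀) k) (child (proj₂ v₂) k)
                        (subst (λ c → Cov 1 c (lookup cs₂ k)) (same k k≢k₀) (cv k)))
            (+-mono-≤ (child≤wt 1 x₀ cs₀ v₀ k) (child≤wt 1 x₂ cs₂ v₂ k))

  height-4 : ∀ {p} → FracPebbling 2 4 p → 1ℚ + 1ℚ + 1ℚ ≤ p
  height-4 {p} fp with between-hits {p} 1 fp
  ... | sandwich {_} {x₂} {cs₁} {cs₂} (source (x₀ , cs₀) ((vx₀ , v₀) , cheap₀) _ hit) ((vx₂ , v₂) , cheap₂) cv =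
    halve-≤ (lin (+-mono-≤ sums (+-mono-≤ (children≤wt 2 x₀ cs₀ vx₀) (+-mono-≤ (children≤wt 2 x₂ cs₂ vx₂)
                   (+-mono-≤ cheap₀ cheap₂))))
                 (arrange p (∑ (λ k → wt 2 (lookup cs₀ k))) (∑ (λ k → wt 2 (lookup cs₂ k)))
                          (wt 3 (x₀ , cs₀)) (wt 3 (x₂ , cs₂))))
    where
    child-weight : _ ⊎ _ → ∀ k → 1ℚ ≤ wt 2 (lookup cs₀ k) + wt 2 (lookup cs₂ k)
    child-weight (inj₁ refl) k = cov-weight 2 (lookup cs₀ k) (lookup cs₂ k) (child v₀ k) (child v₂ k) (cv k)
    child-weight (inj₂ (_ , k₀ , at , same)) k with k ≟ᶠ k₀
    ... | yes refl = cov-hit (lookup cs₀ k) (lookup cs₁ k) (lookup cs₂ k) (child v₀ k) (child v₂ k) at (cv k)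
    ... | no k≢ = cov-weight 2 (lookup cs₀ k) (lookup cs₂ k) (child v₀ k) (child v₂ k)
                    (subst (λ c → Cov 2 c (lookup cs₂ k)) (same k k≢) (cv k))
    sums : 1ℚ + (1ℚ + 0ℚ) ≤ ∑ (λ k → wt 2 (lookup cs₀ k)) + ∑ (λ k → wt 2 (lookup cs₂ k))
    sums = ≤-trans (∑-mono {f = λ _ → 1ℚ} (child-weight hit))
                   (≤-reflexive (∑-+ (λ k → wt 2 (lookup cs₀ k)) (λ k → wt 2 (lookup cs₂ k))))
    arrange : ∀ p A B X Y →
      1ℚ + 1ℚ + 1ℚ + (1ℚ + 1ℚ + 1ℚ) + (A + B + (X + (Y + (p + p))))
        ≡ p + p + (1ℚ + (1ℚ + 0ℚ) + (A + (B + (X + (1ℚ + (1ℚ + 0ℚ)) + (Y + (1ℚ + (1ℚ + 0ℚ)))))))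
    arrange = solve-∀ ring

-- Translation to the stated fractions.

open import Data.Integer using (+_)

/2-· : ∀ k → + k / 2 ≡ k · ½
/2-· zero    = refl
/2-· (suc k) = trans (toℚᵘ-injective split) (cong (λ z → ½ + z) (/2-· k))
  where
  open import Data.Integer.Tactic.RingSolver renaming (solve-∀ to solve-ℤ)
  cross : ∀ z → (+ 1 ℤ.+ z) ℤ.* + 4 ≡ (+ 1 ℤ.* + 2 ℤ.+ z ℤ.* + 2) ℤ.* + 2
  cross = solve-ℤ
  split : toℚᵘ (+ suc k / 2) ℚᵘ.≃ toℚᵘ (½ + + k / 2)
  split = ℚᵘ.≃-trans (toℚᵘ-fromℚᵘ (+ suc k ℚᵘ./ 2))
         (ℚᵘ.≃-trans (ℚᵘ.*≡* (cross (+ k)))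
         (ℚᵘ.≃-trans (ℚᵘ.+-congʳ (+ 1 ℚᵘ./ 2) (ℚᵘ.≃-sym (toℚᵘ-fromℚᵘ (+ k ℚᵘ./ 2))))
                     (ℚᵘ.≃-sym (toℚᵘ-homo-+ ½ (+ k / 2)))))

·-* : ∀ m n q → (m ℕ.* n) · q ≡ m · (n · q)
·-* zero    n q = refl
·-* (suc m) n q = trans (·-distrib-+ n (m ℕ.* n) q) (cong (λ z → n · q + z) (·-* m n q))

half-product : ∀ n h → + (n ℕ.* h) / 2 ≡ h · (n · ½)
half-product n h = trans (/2-· (n ℕ.* h)) (trans (cong (_· ½) (ℕ.*-comm n h)) (·-* h n ½))

-- The charging argument gives `x ≤ p`, that is (d-1)h/2 ≤ p; subtracting `y = d/2` weakens it.
general-lower : ∀ n h p → FracPebbling (suc n) (suc (suc h)) p →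
                + (n ℕ.* suc (suc h)) / 2 - + suc n / 2 ≤ p
general-lower n h p fp = ≤-trans (lin 0≤y (arrange x y)) (halve-≤ {x} {p} x+x≤p+p)
  where
  x = + (n ℕ.* suc (suc h)) / 2
  y = + suc n / 2
  0≤y : 0ℚ ≤ y
  0≤y = ≤-trans (·-nonneg (suc n) (nonNegative⁻¹ ½)) (≤-reflexive (sym (/2-· (suc n))))
  x+x≤p+p : x + x ≤ p + p
  x+x≤p+p = ≤-trans
    (≤-reflexive (trans (cong (λ z → z + z) (half-product n (suc (suc h))))
                 (trans (·-double (suc (suc h)) (n · ½))
                        (cong (suc (suc h) ·_) (·-double n ½)))))
    (Potential.lower n h p fp)
  arrange : ∀ x y → x - y + y ≡ x + 0ℚ
  arrange = solve-∀ ring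

upper : ∀ n h → FracPebbling (suc (suc n)) (suc h) (+ (suc n ℕ.* suc h) / 2 + 1ℚ)
upper n h = subst (FracPebbling (suc (suc n)) (suc h))
  (trans (+-comm 1ℚ (suc h · (suc n · ½))) (cong (_+ 1ℚ) (sym (half-product (suc n) (suc h)))))
  (Strategy.strategy n h)

thrice-half : ∀ d → + (3 ℕ.* d) / 2 ≡ 3 · (d · ½)
thrice-half d = trans (/2-· (3 ℕ.* d)) (·-* 3 d ½)

-- The general strategy attains this value: 1 + 3(d-1)/2 = 3d/2 - 1/2.
upper-3 : ∀ n → FracPebbling (suc (suc n)) 3 (+ (3 ℕ.* suc (suc n)) / 2 - + 1 / 2)
upper-3 n = subst (FracPebbling (suc (suc n)) 3)
  (sym (trans (cong (_- ½) (thrice-half (suc (suc n)))) (arrange ½ (suc n · ½))))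
  (Strategy.strategy n 2)
  where
  arrange : ∀ a k → a + k + (a + k + (a + k + 0ℚ)) - a ≡ a + a + (k + (k + (k + 0ℚ)))
  arrange = solve-∀ ring

lower-3 : ∀ n p → FracPebbling (suc n) 3 p → + (3 ℕ.* suc n) / 2 - + 1 / 2 ≤ p
lower-3 n p fp = halve-≤ (≤-trans
  (≤-reflexive (trans (cong (λ z → z - ½ + (z - ½)) (thrice-half (suc n)))
               (trans (arrange (suc n · ½) ½)
                      (cong (λ z → z + (z + z) - 1ℚ) (·-double (suc n) ½)))))
  (lin (Interval.height-3 n fp) (move (suc n · 1ℚ) p)))
  where
  arrange : ∀ x a → x + (x + (x + 0ℚ)) - a + (x + (x + (x + 0ℚ)) - a)
                      ≡ x + x + (x + x + (x + x)) - (a + a)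
  arrange = solve-∀ ring
  move : ∀ x p → x + (x + x) - 1ℚ + (p + p + 1ℚ) ≡ p + p + (x + (x + x))
  move = solve-∀ ring

theorem4p4 : (∀ (d h : ℕ) → 2 ℕ.≤ d → 2 ℕ.≤ h →
    ((∀ (p : ℚ) → FracPebbling d h p →
    ((+ ((d ∸ 1) ℕ.* h)) / 2) - ((+ d) / 2) ≤ p) ×
    FracPebbling d h (((+ ((d ∸ 1) ℕ.* h)) / 2) + 1ℚ)))
    ×
    (∀ (d : ℕ) → 2 ℕ.≤ d →
    FracPebbling d 3 (((+ (3 ℕ.* d)) / 2) - ((+ 1) / 2)) ×
    (∀ (p : ℚ) → FracPebbling d 3 p → ((+ (3 ℕ.* d)) / 2) - ((+ 1) / 2) ≤ p))
    ×
    (FracPebbling 2 4 ((+ 3) / 1) ×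
    (∀ (p : ℚ) → FracPebbling 2 4 p → (+ 3) / 1 ≤ p))
theorem4p4 =
  (λ { (suc (suc n)) (suc (suc h)) (s≤s (s≤s z≤n)) (s≤s (s≤s z≤n)) →
         general-lower (suc n) h , upper n (suc h) }) ,
  (λ { (suc (suc n)) (s≤s (s≤s z≤n)) → upper-3 n , lower-3 (suc n) }) ,
  -- The budget `1 + 4 · ½` computes to 3.
  (Strategy.strategy 0 3 , λ p → Height4.height-4)
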